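{- Let $K$ be a number field whose ring of integers $\mathcal{O}_K$ is a principal ideal domain. Let $\alpha \in \mathcal{O}_K$ be non-zero with prime ideal factorization $(\alpha) = \mathfrak{p}_1^{e_1} \cdots \mathfrak{p}_g^{e_g}$, with $\mathfrak{p}_1,\dots,\mathfrak{p}_g$ distinct, and let $$n(\alpha) = \frac{1}{h} \sum_{\chi \in \hat{G}} \prod_{i=1}^{g} \left( \sum_{k=0}^{e_i} \chi([\mathfrak{p}_i])^k \right)$$ where $G = Cl(K)$ and $h = |Cl(K)|$. Then this formula reduces to the standard count of divisors in a unique factorization domain: $$n(\alpha) = \prod_{i=1}^{g} (e_i + 1).$$
   Context: $Cl(K)$ is the ideal class group of $K$, $[\mathfrak{p}]$ denotes the class of the ideal $\mathfrak{p}$ in $Cl(K)$, and $\hat{G}$ is the group of all group homomorphisms $\chi : G \to \mathbb{C}^*$. The quantity $n(\alpha)$ denotes the number of principal ideal divisors of $(\alpha)$, i.e. the number of principal ideals of the form $\prod_{i=1}^g \mathfrak{p}_i^{f_i}$ with $0 \le f_i \le e_i$, which is given by the displayed character formula. -}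

module Defs where

open import Algebra.Apartness.Bundles using (HeytingCommutativeRing; HeytingField)
open import Algebra.Bundles using (AbelianGroup; CommutativeMonoid; CommutativeRing; Group)
import Algebra.Morphism.Construct.Composition as Composition
open import Algebra.Morphism.Structures using (IsGroupHomomorphism; IsRingHomomorphism)
import Algebra.Properties.CommutativeMonoid.Mult as Mult
import Algebra.Properties.CommutativeMonoid.Sum as Sum
open import Data.Fin.Base as Fin using (Fin; toℕ; fromℕ; inject₁)
import Data.Fin.Properties as Fin
open import Data.Integer.Base as ℤ using (ℤ)
import Data.Integer.Properties as ℤ
open import Data.List.Base as List using (List; []; _∷_; _++_)
open import Data.List.Relation.Unary.All as All using (All; []; _∷_)
import Data.List.Relation.Unary.All.Properties as All
open import Data.Nat.Base as ℕ using (ℕ; zero; suc)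
import Data.Nat.Properties as ℕ
open import Data.Product.Base using (∃; ∃₂; _×_; _,_; proj₁; proj₂)
open import Data.Rational.Base as ℚ using (ℚ; 0ℚ; 1ℚ)
import Data.Rational.Properties as ℚ
open import Data.Rational.Solver using (module +-*-Solver)
import Data.Rational.Unnormalised.Base as ℚᵘ
import Data.Rational.Unnormalised.Properties as ℚᵘ
open import Data.Sum.Base using (_⊎_)
open import Data.Vec.Functional as Vector using (Vector)
open import Function.Base using (_∘_)
open import Function.Bundles using (Inverse)
open import Level using (0ℓ; _⊔_) renaming (suc to lsuc)
open import Relation.Binary.Bundles using (Setoid)
open import Relation.Binary.PropositionalEquality.Core as ≡ using (_≡_; _≢_)
import Relation.Binary.PropositionalEquality.Properties as ≡
open import Relation.Nullary.Negation.Core using (¬_)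
open import Relation.Unary using (Pred; _∈_; _⊆_; _≐_)

-- ℝ is the setoid of rational Cauchy sequences modulo null sequences.

Close : ℚ → ℚ → ℚ → Set
Close ε p q = ℚ.∣ p ℚ.- q ∣ ℚ.< ε

record ℝ : Set where
  no-eta-equality
  field
    seq    : ℕ → ℚ
    cauchy : ∀ ε → 0ℚ ℚ.< ε → ∃ λ N → ∀ m n → N ℕ.≤ m → N ℕ.≤ n → Close ε (seq m) (seq n)

open ℝ

infix 4 _≈ℝ_
record _≈ℝ_ (x y : ℝ) : Set where
  no-eta-equality
  field
    null : ∀ ε → 0ℚ ℚ.< ε → ∃ λ N → ∀ n → N ℕ.≤ n → Close ε (seq x n) (seq y n)

open _≈ℝ_

private abstract
  close-sym : ∀ {ε} p q → Close ε p q → Close ε q p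
  close-sym p q c = ≡.subst (ℚ._< _) (≡.trans (≡.sym (ℚ.∣-p∣≡∣p∣ (p ℚ.- q))) (≡.cong ℚ.∣_∣ (lemma p q))) c
    where
    lemma : ∀ p q → ℚ.- (p ℚ.- q) ≡ q ℚ.- p
    lemma = solve 2 (λ p q → :- (p :- q) := q :- p) ≡.refl
      where open +-*-Solver

  close-refl : ∀ {ε} p → 0ℚ ℚ.< ε → Close ε p p
  close-refl p 0<ε rewrite ℚ.+-inverseʳ p = 0<ε

  split : ∀ ε → 0ℚ ℚ.< ε → ∃ λ δ → 0ℚ ℚ.< δ × δ ℚ.+ δ ≡ ε
  split ε 0<ε = ε ℚ.* ℚ.½ , pos , ≡.trans (≡.sym (ℚ.*-distribˡ-+ ε ℚ.½ ℚ.½)) (ℚ.*-identityʳ ε)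
    where
    pos : 0ℚ ℚ.< ε ℚ.* ℚ.½
    pos = ℚ.positive⁻¹ (ε ℚ.* ℚ.½) {{ℚ.pos*pos⇒pos ε {{ℚ.positive 0<ε}} ℚ.½}}

  triangle : ∀ p q → ∀ {δ ε η} → δ ℚ.+ ε ≡ η → ℚ.∣ p ∣ ℚ.< δ → ℚ.∣ q ∣ ℚ.< ε → ℚ.∣ p ℚ.+ q ∣ ℚ.< η
  triangle p q ≡.refl a b = ℚ.≤-<-trans (ℚ.∣p+q∣≤∣p∣+∣q∣ p q) (ℚ.+-mono-< a b)

  close-trans : ∀ {δ ε} p q r → δ ℚ.+ δ ≡ ε → Close δ p q → Close δ q r → Close ε p r
  close-trans p q r eq a b = ≡.subst (λ t → ℚ.∣ t ∣ ℚ.< _) (lemma p q r) (triangle (p ℚ.- q) (q ℚ.- r) eq a b)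
    where
    lemma : ∀ p q r → (p ℚ.- q) ℚ.+ (q ℚ.- r) ≡ p ℚ.- r
    lemma = solve 3 (λ p q r → (p :- q) :+ (q :- r) := p :- r) ≡.refl
      where open +-*-Solver

  close-+ : ∀ {δ ε} p p′ q q′ → δ ℚ.+ δ ≡ ε → Close δ p p′ → Close δ q q′ → Close ε (p ℚ.+ q) (p′ ℚ.+ q′)
  close-+ p p′ q q′ eq a b = ≡.subst (λ t → ℚ.∣ t ∣ ℚ.< _) (lemma p p′ q q′) (triangle (p ℚ.- p′) (q ℚ.- q′) eq a b)
    where
    lemma : ∀ p p′ q q′ → (p ℚ.- p′) ℚ.+ (q ℚ.- q′) ≡ (p ℚ.+ q) ℚ.- (p′ ℚ.+ q′)
    lemma = solve 4 (λ p p′ q q′ → (p :- p′) :+ (q :- q′) := (p :+ q) :- (p′ :+ q′)) ≡.refl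
      where open +-*-Solver

  close-neg : ∀ {ε} p q → Close ε p q → Close ε (ℚ.- p) (ℚ.- q)
  close-neg p q c = ≡.subst (λ t → ℚ.∣ t ∣ ℚ.< _) (lemma p q) (close-sym p q c)
    where
    lemma : ∀ p q → q ℚ.- p ≡ (ℚ.- p) ℚ.- (ℚ.- q)
    lemma = solve 2 (λ p q → q :- p := (:- p) :- (:- q)) ≡.refl
      where open +-*-Solver

  scale : ∀ B → 0ℚ ℚ.< B → ∀ ε → 0ℚ ℚ.< ε → ∃ λ δ → 0ℚ ℚ.< δ × B ℚ.* δ ≡ ε
  scale B 0<B ε 0<ε = 1/B ℚ.* ε , ℚ.positive⁻¹ _ {{ℚ.pos*pos⇒pos 1/B {{ℚ.1/pos⇒pos B}} ε {{ℚ.positive 0<ε}}}} ,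
    ≡.trans (≡.sym (ℚ.*-assoc B 1/B ε)) (≡.trans (≡.cong (ℚ._* ε) (ℚ.*-inverseʳ B)) (ℚ.*-identityˡ ε))
    where
    instance
      B-pos : ℚ.Positive B
      B-pos = ℚ.positive 0<B
      B-nonZero : ℚ.NonZero B
      B-nonZero = ℚ.pos⇒nonZero B
    1/B : ℚ
    1/B = ℚ.1/ B

  prod-bound : ∀ {B δ} → 0ℚ ℚ.< B → ∀ p q → ℚ.∣ p ∣ ℚ.≤ B → ℚ.∣ q ∣ ℚ.< δ → ℚ.∣ p ℚ.* q ∣ ℚ.< B ℚ.* δ
  prod-bound {B} {δ} 0<B p q a b = ≡.subst (ℚ._< B ℚ.* δ) (≡.sym (ℚ.∣p*q∣≡∣p∣*∣q∣ p q))
    (ℚ.≤-<-trans (ℚ.*-monoʳ-≤-nonNeg ℚ.∣ q ∣ {{ℚ.∣-∣-nonNeg q}} a) (ℚ.*-monoʳ-<-pos B {{ℚ.positive 0<B}} b))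

  mult-modulus : ∀ B → 0ℚ ℚ.< B → ∀ ε → 0ℚ ℚ.< ε → ∃ λ δ → 0ℚ ℚ.< δ ×
    (∀ p p′ q q′ → ℚ.∣ p ∣ ℚ.≤ B → ℚ.∣ q′ ∣ ℚ.≤ B → Close δ p p′ → Close δ q q′ → Close ε (p ℚ.* q) (p′ ℚ.* q′))
  mult-modulus B 0<B ε 0<ε with split ε 0<ε
  ... | η , 0<η , η+η≡ε with scale B 0<B η 0<η
  ... | δ , 0<δ , ≡.refl = δ , 0<δ , λ p p′ q q′ a b c d →
    ≡.subst (λ t → ℚ.∣ t ∣ ℚ.< _) (lemma p p′ q q′)
      (triangle (p ℚ.* (q ℚ.- q′)) (q′ ℚ.* (p ℚ.- p′)) η+η≡ε
        (prod-bound 0<B p (q ℚ.- q′) a d) (prod-bound 0<B q′ (p ℚ.- p′) b c))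
    where
    lemma : ∀ p p′ q q′ → p ℚ.* (q ℚ.- q′) ℚ.+ q′ ℚ.* (p ℚ.- p′) ≡ (p ℚ.* q) ℚ.- (p′ ℚ.* q′)
    lemma = solve 4 (λ p p′ q q′ → p :* (q :- q′) :+ q′ :* (p :- p′) := (p :* q) :- (p′ :* q′)) ≡.refl
      where open +-*-Solver

  0<1 : 0ℚ ℚ.< 1ℚ
  0<1 = ℚ.positive⁻¹ 1ℚ

  step-pos : ∀ p → 0ℚ ℚ.< ℚ.∣ p ∣ ℚ.+ 1ℚ
  step-pos p = ℚ.≤-<-trans (ℚ.0≤∣p∣ p)
    (≡.subst (ℚ._< ℚ.∣ p ∣ ℚ.+ 1ℚ) (ℚ.+-identityʳ ℚ.∣ p ∣) (ℚ.+-monoʳ-< ℚ.∣ p ∣ 0<1))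

  step-bound : ∀ p q → Close 1ℚ q p → ℚ.∣ q ∣ ℚ.≤ ℚ.∣ p ∣ ℚ.+ 1ℚ
  step-bound p q c = ≡.subst (λ t → ℚ.∣ t ∣ ℚ.≤ ℚ.∣ p ∣ ℚ.+ 1ℚ) (lemma p q)
    (ℚ.≤-trans (ℚ.∣p+q∣≤∣p∣+∣q∣ p (q ℚ.- p)) (ℚ.+-monoʳ-≤ ℚ.∣ p ∣ (ℚ.<⇒≤ c)))
    where
    lemma : ∀ p q → p ℚ.+ (q ℚ.- p) ≡ q
    lemma = solve 2 (λ p q → p :+ (q :- p) := q) ≡.refl
      where open +-*-Solver

  bounded : ∀ x → ∃₂ λ B N → 0ℚ ℚ.< B × (∀ n → N ℕ.≤ n → ℚ.∣ seq x n ∣ ℚ.≤ B)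
  bounded x = let N , c = cauchy x 1ℚ 0<1 in
    ℚ.∣ seq x N ∣ ℚ.+ 1ℚ , N , step-pos (seq x N) ,
    λ n N≤n → step-bound (seq x N) (seq x n) (c n N N≤n ℕ.≤-refl)

  ≤-+ʳ : ∀ p q → 0ℚ ℚ.< q → p ℚ.≤ p ℚ.+ q
  ≤-+ʳ p q 0<q = ≡.subst (ℚ._≤ p ℚ.+ q) (ℚ.+-identityʳ p) (ℚ.+-monoʳ-≤ p (ℚ.<⇒≤ 0<q))

  ≤-+ˡ : ∀ p q → 0ℚ ℚ.< p → q ℚ.≤ p ℚ.+ q
  ≤-+ˡ p q 0<p = ≡.subst (q ℚ.≤_) (ℚ.+-comm q p) (≤-+ʳ q p 0<p)

  bounded₂ : ∀ x y → ∃₂ λ B N → 0ℚ ℚ.< B ×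
    (∀ n → N ℕ.≤ n → ℚ.∣ seq x n ∣ ℚ.≤ B × ℚ.∣ seq y n ∣ ℚ.≤ B)
  bounded₂ x y =
    let B , M , 0<B , b = bounded x
        C , N , 0<C , c = bounded y
    in B ℚ.+ C , M ℕ.⊔ N , ℚ.<-≤-trans 0<B (≤-+ʳ B C 0<C) , λ n le →
      ℚ.≤-trans (b n (ℕ.m⊔n≤o⇒m≤o M N le)) (≤-+ʳ B C 0<C) ,
      ℚ.≤-trans (c n (ℕ.m⊔n≤o⇒n≤o M N le)) (≤-+ˡ B C 0<B)

abstract
  pointwise : ∀ {x y} → (∀ n → seq x n ≡ seq y n) → x ≈ℝ y
  null (pointwise {x} {y} eq) ε 0<ε = 0 , λ n _ → ≡.subst (Close ε (seq x n)) (eq n) (close-refl (seq x n) 0<ε)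

ℚ⇒ℝ : ℚ → ℝ
ℚ⇒ℝ q = record { seq = λ _ → q ; cauchy = λ ε 0<ε → 0 , λ _ _ _ _ → close-refl q 0<ε }

infixl 6 _+ℝ_
_+ℝ_ : ℝ → ℝ → ℝ
seq (x +ℝ y) n = seq x n ℚ.+ seq y n
cauchy (x +ℝ y) ε 0<ε with split ε 0<ε
... | δ , 0<δ , eq with cauchy x δ 0<δ | cauchy y δ 0<δ
... | M , a | N , b = M ℕ.⊔ N , λ m n p q →
  close-+ (seq x m) (seq x n) (seq y m) (seq y n) eq
    (a m n (ℕ.m⊔n≤o⇒m≤o M N p) (ℕ.m⊔n≤o⇒m≤o M N q))
    (b m n (ℕ.m⊔n≤o⇒n≤o M N p) (ℕ.m⊔n≤o⇒n≤o M N q))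

infix 8 -ℝ_
-ℝ_ : ℝ → ℝ
seq (-ℝ x) n = ℚ.- seq x n
cauchy (-ℝ x) ε 0<ε with cauchy x ε 0<ε
... | N , a = N , λ m n p q → close-neg (seq x m) (seq x n) (a m n p q)

infixl 7 _*ℝ_
_*ℝ_ : ℝ → ℝ → ℝ
seq (x *ℝ y) n = seq x n ℚ.* seq y n
cauchy (x *ℝ y) ε 0<ε with bounded₂ x y
... | B , L , 0<B , bound with mult-modulus B 0<B ε 0<ε
... | δ , 0<δ , close with cauchy x δ 0<δ | cauchy y δ 0<δ
... | M , a | N , b = L ℕ.⊔ (M ℕ.⊔ N) , λ m n p q →
  let p′ = ℕ.m⊔n≤o⇒n≤o L (M ℕ.⊔ N) p ; q′ = ℕ.m⊔n≤o⇒n≤o L (M ℕ.⊔ N) q in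
  close (seq x m) (seq x n) (seq y m) (seq y n)
    (proj₁ (bound m (ℕ.m⊔n≤o⇒m≤o L _ p))) (proj₂ (bound n (ℕ.m⊔n≤o⇒m≤o L _ q)))
    (a m n (ℕ.m⊔n≤o⇒m≤o M N p′) (ℕ.m⊔n≤o⇒m≤o M N q′))
    (b m n (ℕ.m⊔n≤o⇒n≤o M N p′) (ℕ.m⊔n≤o⇒n≤o M N q′))

private
  ≈ℝ-refl : ∀ {x} → x ≈ℝ x
  null (≈ℝ-refl {x}) ε 0<ε = 0 , λ n _ → close-refl (seq x n) 0<ε

  ≈ℝ-sym : ∀ {x y} → x ≈ℝ y → y ≈ℝ x
  null (≈ℝ-sym {x} {y} e) ε 0<ε with null e ε 0<ε
  ... | N , a = N , λ n p → close-sym (seq x n) (seq y n) (a n p)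

  ≈ℝ-trans : ∀ {x y z} → x ≈ℝ y → y ≈ℝ z → x ≈ℝ z
  null (≈ℝ-trans {x} {y} {z} e f) ε 0<ε with split ε 0<ε
  ... | δ , 0<δ , eq with null e δ 0<δ | null f δ 0<δ
  ... | M , a | N , b = M ℕ.⊔ N , λ n p →
    close-trans (seq x n) (seq y n) (seq z n) eq (a n (ℕ.m⊔n≤o⇒m≤o M N p)) (b n (ℕ.m⊔n≤o⇒n≤o M N p))

  +ℝ-cong : ∀ {x x′ y y′} → x ≈ℝ x′ → y ≈ℝ y′ → x +ℝ y ≈ℝ x′ +ℝ y′
  null (+ℝ-cong {x} {x′} {y} {y′} e f) ε 0<ε with split ε 0<ε
  ... | δ , 0<δ , eq with null e δ 0<δ | null f δ 0<δ
  ... | M , a | N , b = M ℕ.⊔ N , λ n p →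
    close-+ (seq x n) (seq x′ n) (seq y n) (seq y′ n) eq
      (a n (ℕ.m⊔n≤o⇒m≤o M N p)) (b n (ℕ.m⊔n≤o⇒n≤o M N p))

  -ℝ-cong : ∀ {x y} → x ≈ℝ y → -ℝ x ≈ℝ -ℝ y
  null (-ℝ-cong {x} {y} e) ε 0<ε with null e ε 0<ε
  ... | N , a = N , λ n p → close-neg (seq x n) (seq y n) (a n p)

  *ℝ-cong : ∀ {x x′ y y′} → x ≈ℝ x′ → y ≈ℝ y′ → x *ℝ y ≈ℝ x′ *ℝ y′
  null (*ℝ-cong {x} {x′} {y} {y′} e f) ε 0<ε with bounded₂ x y′
  ... | B , L , 0<B , bound with mult-modulus B 0<B ε 0<ε
  ... | δ , 0<δ , close with null e δ 0<δ | null f δ 0<δ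
  ... | M , a | N , b = L ℕ.⊔ (M ℕ.⊔ N) , λ n p →
    let p′ = ℕ.m⊔n≤o⇒n≤o L (M ℕ.⊔ N) p ; bₙ = bound n (ℕ.m⊔n≤o⇒m≤o L _ p) in
    close (seq x n) (seq x′ n) (seq y n) (seq y′ n) (proj₁ bₙ) (proj₂ bₙ)
      (a n (ℕ.m⊔n≤o⇒m≤o M N p′)) (b n (ℕ.m⊔n≤o⇒n≤o M N p′))

ℝ-commutativeRing : CommutativeRing 0ℓ 0ℓ
ℝ-commutativeRing = record
  { Carrier = ℝ
  ; _≈_ = _≈ℝ_
  ; _+_ = _+ℝ_
  ; _*_ = _*ℝ_
  ; -_ = -ℝ_
  ; 0# = ℚ⇒ℝ 0ℚ
  ; 1# = ℚ⇒ℝ 1ℚ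
  ; isCommutativeRing = record
    { isRing = record
      { +-isAbelianGroup = record
        { isGroup = record
          { isMonoid = record
            { isSemigroup = record
              { isMagma = record
                { isEquivalence = record
                  { refl = ≈ℝ-refl
                  ; sym = ≈ℝ-sym
                  ; trans = ≈ℝ-trans
                  }
                ; ∙-cong = +ℝ-cong
                }
              ; assoc = λ x y z → pointwise λ n → ℚ.+-assoc (seq x n) (seq y n) (seq z n)
              }
            ; identity = (λ x → pointwise λ n → ℚ.+-identityˡ (seq x n))
                       , (λ x → pointwise λ n → ℚ.+-identityʳ (seq x n))
            }
          ; inverse = (λ x → pointwise λ n → ℚ.+-inverseˡ (seq x n))
                    , (λ x → pointwise λ n → ℚ.+-inverseʳ (seq x n))
          ; ⁻¹-cong = -ℝ-cong
          }
        ; comm = λ x y → pointwise λ n → ℚ.+-comm (seq x n) (seq y n)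
        }
      ; *-cong = *ℝ-cong
      ; *-assoc = λ x y z → pointwise λ n → ℚ.*-assoc (seq x n) (seq y n) (seq z n)
      ; *-identity = (λ x → pointwise λ n → ℚ.*-identityˡ (seq x n))
                   , (λ x → pointwise λ n → ℚ.*-identityʳ (seq x n))
      ; distrib = (λ x y z → pointwise λ n → ℚ.*-distribˡ-+ (seq x n) (seq y n) (seq z n))
                , (λ x y z → pointwise λ n → ℚ.*-distribʳ-+ (seq x n) (seq y n) (seq z n))
      }
    ; *-comm = λ x y → pointwise λ n → ℚ.*-comm (seq x n) (seq y n)
    }
  }

infix 5 _+i_
record ℂ : Set where
  constructor _+i_
  field
    re im : ℝ

open ℂ

infix 4 _≈ℂ_
record _≈ℂ_ (z w : ℂ) : Set where
  constructor _,_
  field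
    re≈ : re z ≈ℝ re w
    im≈ : im z ≈ℝ im w

infixl 6 _+ℂ_
_+ℂ_ : ℂ → ℂ → ℂ
(a +i b) +ℂ (c +i d) = (a +ℝ c) +i (b +ℝ d)

infixl 7 _*ℂ_
_*ℂ_ : ℂ → ℂ → ℂ
(a +i b) *ℂ (c +i d) = (a *ℝ c +ℝ -ℝ (b *ℝ d)) +i (a *ℝ d +ℝ b *ℝ c)

infix 8 -ℂ_
-ℂ_ : ℂ → ℂ
-ℂ (a +i b) = (-ℝ a) +i (-ℝ b)

ℝ⇒ℂ : ℝ → ℂ
ℝ⇒ℂ x = x +i ℚ⇒ℝ 0ℚ

ℚ⇒ℂ : ℚ → ℂ
ℚ⇒ℂ = ℝ⇒ℂ ∘ ℚ⇒ℝ

ℕ⇒ℂ : ℕ → ℂ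
ℕ⇒ℂ n = ℚ⇒ℂ (ℤ.+ n ℚ./ 1)

ℂ-commutativeRing : CommutativeRing 0ℓ 0ℓ
ℂ-commutativeRing = record
  { Carrier = ℂ
  ; _≈_ = _≈ℂ_
  ; _+_ = _+ℂ_
  ; _*_ = _*ℂ_
  ; -_ = -ℂ_
  ; 0# = ℝ⇒ℂ (ℚ⇒ℝ 0ℚ)
  ; 1# = ℝ⇒ℂ (ℚ⇒ℝ 1ℚ)
  ; isCommutativeRing = record
    { isRing = record
      { +-isAbelianGroup = record
        { isGroup = record
          { isMonoid = record
            { isSemigroup = record
              { isMagma = record
                { isEquivalence = record
                  { refl = λ { {a +i b} → R.refl , R.refl }
                  ; sym = λ { {a +i b} {c +i d} (p , q) → R.sym p , R.sym q }
                  ; trans = λ { {a +i b} {c +i d} {e +i f} (p , q) (r , s) →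
                      R.trans p r , R.trans q s }
                  }
                ; ∙-cong = λ { {a +i b} {a′ +i b′} {c +i d} {c′ +i d′} (p , q) (r , s) →
                    R.+-cong p r , R.+-cong q s }
                }
              ; assoc = λ { (a +i b) (c +i d) (e +i f) → R.+-assoc a c e , R.+-assoc b d f }
              }
            ; identity = (λ { (a +i b) → R.+-identityˡ a , R.+-identityˡ b })
                       , (λ { (a +i b) → R.+-identityʳ a , R.+-identityʳ b })
            }
          ; inverse = (λ { (a +i b) → R.-‿inverseˡ a , R.-‿inverseˡ b })
                    , (λ { (a +i b) → R.-‿inverseʳ a , R.-‿inverseʳ b })
          ; ⁻¹-cong = λ { {a +i b} {c +i d} (p , q) → R.-‿cong p , R.-‿cong q }
          }
        ; comm = λ { (a +i b) (c +i d) → R.+-comm a c , R.+-comm b d }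
        }
      ; *-cong = *-cong
      ; *-assoc = *-assoc
      ; *-identity = *-identityˡ , *-identityʳ
      ; distrib = *-distribˡ , *-distribʳ
      }
    ; *-comm = *-comm
    }
  }
  where
  open +-*-Solver using (solve; _:+_; _:*_; _:-_; :-_; _:=_; con)
  module R = CommutativeRing ℝ-commutativeRing

  *-cong : ∀ {z z′ w w′} → z ≈ℂ z′ → w ≈ℂ w′ → z *ℂ w ≈ℂ z′ *ℂ w′
  *-cong {a +i b} {a′ +i b′} {c +i d} {c′ +i d′} (p , q) (r , s) =
    R.+-cong (R.*-cong p r)
      (R.-‿cong (R.*-cong q s)) ,
    R.+-cong
      (R.*-cong p s) (R.*-cong q r)

  pointwiseℂ : ∀ {z w} → (∀ n → seq (re z) n ≡ seq (re w) n) → (∀ n → seq (im z) n ≡ seq (im w) n) → z ≈ℂ w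
  pointwiseℂ p q = pointwise p , pointwise q

  *-comm : ∀ z w → z *ℂ w ≈ℂ w *ℂ z
  *-comm z@(a +i b) w@(c +i d) = pointwiseℂ
    (λ n → lemma₁ (seq a n) (seq b n) (seq c n) (seq d n))
    (λ n → lemma₂ (seq a n) (seq b n) (seq c n) (seq d n))
    where
    lemma₁ : ∀ a b c d → a ℚ.* c ℚ.+ ℚ.- (b ℚ.* d) ≡ c ℚ.* a ℚ.+ ℚ.- (d ℚ.* b)
    lemma₁ = solve 4 (λ a b c d → a :* c :+ :- (b :* d) := c :* a :+ :- (d :* b)) ≡.refl
    lemma₂ : ∀ a b c d → a ℚ.* d ℚ.+ b ℚ.* c ≡ c ℚ.* b ℚ.+ d ℚ.* a
    lemma₂ = solve 4 (λ a b c d → a :* d :+ b :* c := c :* b :+ d :* a) ≡.refl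

  *-identityˡ : ∀ z → ℝ⇒ℂ (ℚ⇒ℝ 1ℚ) *ℂ z ≈ℂ z
  *-identityˡ z@(a +i b) = pointwiseℂ
    (λ n → lemma₁ (seq a n) (seq b n)) (λ n → lemma₂ (seq a n) (seq b n))
    where
    lemma₁ : ∀ a b → 1ℚ ℚ.* a ℚ.+ ℚ.- (0ℚ ℚ.* b) ≡ a
    lemma₁ = solve 2 (λ a b → con 1ℚ :* a :+ :- (con 0ℚ :* b) := a) ≡.refl
    lemma₂ : ∀ a b → 1ℚ ℚ.* b ℚ.+ 0ℚ ℚ.* a ≡ b
    lemma₂ = solve 2 (λ a b → con 1ℚ :* b :+ con 0ℚ :* a := b) ≡.refl

  *-assoc : ∀ z w u → z *ℂ w *ℂ u ≈ℂ z *ℂ (w *ℂ u)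
  *-assoc z@(a +i b) w@(c +i d) u@(e +i f) = pointwiseℂ
    (λ n → lemma₁ (seq a n) (seq b n) (seq c n) (seq d n) (seq e n) (seq f n))
    (λ n → lemma₂ (seq a n) (seq b n) (seq c n) (seq d n) (seq e n) (seq f n))
    where
    lemma₁ : ∀ a b c d e f → (a ℚ.* c ℚ.+ ℚ.- (b ℚ.* d)) ℚ.* e ℚ.+ ℚ.- ((a ℚ.* d ℚ.+ b ℚ.* c) ℚ.* f) ≡
      a ℚ.* (c ℚ.* e ℚ.+ ℚ.- (d ℚ.* f)) ℚ.+ ℚ.- (b ℚ.* (c ℚ.* f ℚ.+ d ℚ.* e))
    lemma₁ = solve 6 (λ a b c d e f → (a :* c :+ :- (b :* d)) :* e :+ :- ((a :* d :+ b :* c) :* f) := a :* (c :* e :+ :- (d :* f)) :+ :- (b :* (c :* f :+ d :* e))) ≡.refl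
    lemma₂ : ∀ a b c d e f → (a ℚ.* c ℚ.+ ℚ.- (b ℚ.* d)) ℚ.* f ℚ.+ (a ℚ.* d ℚ.+ b ℚ.* c) ℚ.* e ≡
      a ℚ.* (c ℚ.* f ℚ.+ d ℚ.* e) ℚ.+ b ℚ.* (c ℚ.* e ℚ.+ ℚ.- (d ℚ.* f))
    lemma₂ = solve 6 (λ a b c d e f → (a :* c :+ :- (b :* d)) :* f :+ (a :* d :+ b :* c) :* e := a :* (c :* f :+ d :* e) :+ b :* (c :* e :+ :- (d :* f))) ≡.refl

  *-distribˡ : ∀ z w u → z *ℂ (w +ℂ u) ≈ℂ z *ℂ w +ℂ z *ℂ u
  *-distribˡ z@(a +i b) w@(c +i d) u@(e +i f) = pointwiseℂ
    (λ n → lemma₁ (seq a n) (seq b n) (seq c n) (seq d n) (seq e n) (seq f n))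
    (λ n → lemma₂ (seq a n) (seq b n) (seq c n) (seq d n) (seq e n) (seq f n))
    where
    lemma₁ : ∀ a b c d e f → a ℚ.* (c ℚ.+ e) ℚ.+ ℚ.- (b ℚ.* (d ℚ.+ f)) ≡
      (a ℚ.* c ℚ.+ ℚ.- (b ℚ.* d)) ℚ.+ (a ℚ.* e ℚ.+ ℚ.- (b ℚ.* f))
    lemma₁ = solve 6 (λ a b c d e f → a :* (c :+ e) :+ :- (b :* (d :+ f)) := (a :* c :+ :- (b :* d)) :+ (a :* e :+ :- (b :* f))) ≡.refl
    lemma₂ : ∀ a b c d e f → a ℚ.* (d ℚ.+ f) ℚ.+ b ℚ.* (c ℚ.+ e) ≡
      (a ℚ.* d ℚ.+ b ℚ.* c) ℚ.+ (a ℚ.* f ℚ.+ b ℚ.* e)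
    lemma₂ = solve 6 (λ a b c d e f → a :* (d :+ f) :+ b :* (c :+ e) := (a :* d :+ b :* c) :+ (a :* f :+ b :* e)) ≡.refl

  *-identityʳ : ∀ z → z *ℂ ℝ⇒ℂ (ℚ⇒ℝ 1ℚ) ≈ℂ z
  *-identityʳ z@(a +i b) = pointwiseℂ
    (λ n → lemma₁ (seq a n) (seq b n)) (λ n → lemma₂ (seq a n) (seq b n))
    where
    lemma₁ : ∀ a b → a ℚ.* 1ℚ ℚ.+ ℚ.- (b ℚ.* 0ℚ) ≡ a
    lemma₁ = solve 2 (λ a b → a :* con 1ℚ :+ :- (b :* con 0ℚ) := a) ≡.refl
    lemma₂ : ∀ a b → a ℚ.* 0ℚ ℚ.+ b ℚ.* 1ℚ ≡ b
    lemma₂ = solve 2 (λ a b → a :* con 0ℚ :+ b :* con 1ℚ := b) ≡.refl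

  *-distribʳ : ∀ z w u → (w +ℂ u) *ℂ z ≈ℂ w *ℂ z +ℂ u *ℂ z
  *-distribʳ z@(a +i b) w@(c +i d) u@(e +i f) = pointwiseℂ
    (λ n → lemma₁ (seq a n) (seq b n) (seq c n) (seq d n) (seq e n) (seq f n))
    (λ n → lemma₂ (seq a n) (seq b n) (seq c n) (seq d n) (seq e n) (seq f n))
    where
    lemma₁ : ∀ a b c d e f → (c ℚ.+ e) ℚ.* a ℚ.+ ℚ.- ((d ℚ.+ f) ℚ.* b) ≡
      (c ℚ.* a ℚ.+ ℚ.- (d ℚ.* b)) ℚ.+ (e ℚ.* a ℚ.+ ℚ.- (f ℚ.* b))
    lemma₁ = solve 6 (λ a b c d e f → (c :+ e) :* a :+ :- ((d :+ f) :* b) := (c :* a :+ :- (d :* b)) :+ (e :* a :+ :- (f :* b))) ≡.refl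
    lemma₂ : ∀ a b c d e f → (c ℚ.+ e) ℚ.* b ℚ.+ (d ℚ.+ f) ℚ.* a ≡
      (c ℚ.* b ℚ.+ d ℚ.* a) ℚ.+ (e ℚ.* b ℚ.+ f ℚ.* a)
    lemma₂ = solve 6 (λ a b c d e f → (c :+ e) :* b :+ (d :+ f) :* a := (c :* b :+ d :* a) :+ (e :* b :+ f :* a)) ≡.refl

module Integrality {c ℓ} (R : CommutativeRing c ℓ) (φ : ℤ → CommutativeRing.Carrier R)
  (φ-hom : IsRingHomomorphism ℤ.+-*-rawRing (CommutativeRing.rawRing R) φ) where

  open CommutativeRing R
  open import Algebra.Properties.Semiring.Exp semiring using (_^_)
  open import Algebra.Properties.Semiring.Sum semiring using (sum; sum-syntax; sum-init-last; sum-cong-≋)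
  open import Algebra.Properties.Ring ring using (-1*x≈-x)
  open import Algebra.Solver.Ring.NaturalCoefficients.Default commutativeSemiring
  open import Relation.Binary.Reasoning.Setoid setoid
  private module φ = IsRingHomomorphism φ-hom

  Integral : Pred Carrier ℓ
  Integral x = ∃₂ λ n (a : Vector ℤ n) → x ^ n + ∑[ i < n ] (φ (a i) * x ^ toℕ i) ≈ 0#

  -- Sums and products of integral elements are integral: if a finitely generated
  -- ℤ-module containing 1 is stable under z, eliminating its generators one by one
  -- yields a monic relation for z (this replaces the determinant argument).
  private
    Int : Pred Carrier ℓ
    Int a = ∃ λ k → a ≈ φ k

    int-0 : Int 0#
    int-0 = ℤ.0ℤ , sym φ.0#-homo

    int-1 : Int 1#
    int-1 = ℤ.1ℤ , sym φ.1#-homo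

    int-+ : ∀ {a b} → Int a → Int b → Int (a + b)
    int-+ (j , p) (k , q) = j ℤ.+ k , trans (+-cong p q) (sym (φ.+-homo j k))

    int-* : ∀ {a b} → Int a → Int b → Int (a * b)
    int-* (j , p) (k , q) = j ℤ.* k , trans (*-cong p q) (sym (φ.*-homo j k))

    int--1 : Int (- 1#)
    int--1 = ℤ.- ℤ.1ℤ , trans (-‿cong (sym φ.1#-homo)) (sym (φ.-‿homo ℤ.1ℤ))

    data Span {p} (C : Pred Carrier p) : List Carrier → Pred Carrier (c ⊔ ℓ ⊔ p) where
      nil  : ∀ {z} → z ≈ 0# → Span C [] z
      cons : ∀ {v vs z} a w → C a → Span C vs w → z ≈ w + a * v → Span C (v ∷ vs) z

    module _ {p} {C : Pred Carrier p} where
      span-resp : ∀ {vs x y} → x ≈ y → Span C vs x → Span C vs y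
      span-resp e (nil z≈0) = nil (trans (sym e) z≈0)
      span-resp e (cons a w Ca s z≈) = cons a w Ca s (trans (sym e) z≈)

      span-scale : ∀ {q} {D : Pred Carrier q} {vs w} r → (∀ {a} → C a → D (r * a)) →
                   Span C vs w → Span D vs (r * w)
      span-scale r f (nil z≈0) = nil (trans (*-congˡ z≈0) (zeroʳ r))
      span-scale {vs = v ∷ _} r f (cons a w Ca s z≈) = cons (r * a) (r * w) (f Ca) (span-scale r f s)
        (trans (*-congˡ z≈) (solve 4 (λ r w a v → r :* (w :+ a :* v) := r :* w :+ r :* a :* v) refl r w a v))

      span-map : ∀ {q} {D : Pred Carrier q} {vs w} → (∀ {a} → C a → D a) → Span C vs w → Span D vs w
      span-map f (nil z≈0) = nil z≈0
      span-map f (cons a w Ca s z≈) = cons a w (f Ca) (span-map f s) z≈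

      span-generators : ∀ {vs w} r → Span C vs w → Span C (List.map (r *_) vs) (r * w)
      span-generators r (nil z≈0) = nil (trans (*-congˡ z≈0) (zeroʳ r))
      span-generators {v ∷ _} r (cons a w Ca s z≈) = cons a (r * w) Ca (span-generators r s)
        (trans (*-congˡ z≈) (solve 4 (λ r w a v → r :* (w :+ a :* v) := r :* w :+ a :* (r :* v)) refl r w a v))

      span-++ : ∀ {us vs x y} → Span C us x → Span C vs y → Span C (us ++ vs) (x + y)
      span-++ (nil z≈0) t = span-resp (trans (sym (+-identityˡ _)) (+-congʳ (sym z≈0))) t
      span-++ {v ∷ _} {y = y} (cons a w Ca s z≈) t = cons a (w + y) Ca (span-++ s t)
        (trans (+-congʳ z≈) (solve 4 (λ w a v y → w :+ a :* v :+ y := w :+ y :+ a :* v) refl w a v y))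

      span-annihilated : ∀ {vs w r} → All (λ v → r * v ≈ 0#) vs → Span C vs w → r * w ≈ 0#
      span-annihilated [] (nil z≈0) = trans (*-congˡ z≈0) (zeroʳ _)
      span-annihilated {v ∷ _} {r = r} (e ∷ es) (cons a w Ca s z≈) = begin
        r * _               ≈⟨ *-congˡ z≈ ⟩
        r * (w + a * v)     ≈⟨ solve 4 (λ r w a v → r :* (w :+ a :* v) := r :* w :+ a :* (r :* v)) refl r w a v ⟩
        r * w + a * (r * v) ≈⟨ +-cong (span-annihilated es s) (*-congˡ e) ⟩
        0# + a * 0#         ≈⟨ +-identityˡ _ ⟩
        a * 0#              ≈⟨ zeroʳ a ⟩
        0#                  ∎

      module _ (C-0 : C 0#) where
        span-0 : ∀ vs → Span C vs 0#
        span-0 [] = nil refl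
        span-0 (v ∷ vs) = cons 0# 0# C-0 (span-0 vs) (solve 1 (λ v → con 0 := con 0 :+ con 0 :* v) refl v)

        span-weaken : ∀ {v vs w} → Span C vs w → Span C (v ∷ vs) w
        span-weaken {v} {w = w} s = cons 0# w C-0 s (solve 2 (λ w v → w := w :+ con 0 :* v) refl w v)

      module _ (C-+ : ∀ {a b} → C a → C b → C (a + b)) where
        span-+ : ∀ {vs x y} → Span C vs x → Span C vs y → Span C vs (x + y)
        span-+ (nil p) (nil q) = nil (trans (+-cong p q) (+-identityˡ 0#))
        span-+ {v ∷ _} (cons a w Ca s p) (cons b u Cb t q) = cons (a + b) (w + u) (C-+ Ca Cb) (span-+ s t)
          (trans (+-cong p q) (solve 5 (λ w a v u b → (w :+ a :* v) :+ (u :+ b :* v) := (w :+ u) :+ (a :+ b) :* v) refl w a v u b))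

    powers : Carrier → ℕ → List Carrier
    powers x zero    = []
    powers x (suc d) = x ^ d ∷ powers x d

    module Powers (x : Carrier) where
      -- values at x of integer polynomials of degree < d, resp. monic of degree d
      Low : ℕ → Pred Carrier (c ⊔ ℓ)
      Low d = Span Int (powers x d)

      Monic : ℕ → Pred Carrier (c ⊔ ℓ)
      Monic d p = ∃ λ w → Low d w × p ≈ x ^ d + w

      low-+ : ∀ {d u v} → Low d u → Low d v → Low d (u + v)
      low-+ = span-+ int-+

      low-scale : ∀ {d u a} → Int a → Low d u → Low d (a * u)
      low-scale {a = a} k = span-scale a (int-* k)

      low-suc : ∀ {d u} → Low d u → Low (suc d) u
      low-suc = span-weaken int-0

      low-weaken : ∀ {d u} e → Low d u → Low (e ℕ.+ d) u
      low-weaken zero    s = s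
      low-weaken (suc e) s = low-suc (low-weaken e s)

      low-const : ∀ {a} → Int a → Low 1 a
      low-const {a} k = cons a 0# k (nil refl) (solve 1 (λ a → a := con 0 :+ a :* con 1) refl a)

      low-x : ∀ {d u} → Low d u → Low (suc d) (x * u)
      low-x {zero} (nil z≈0) = low-suc (nil (trans (*-congˡ z≈0) (zeroʳ x)))
      low-x {suc d} (cons a w k s z≈) = cons a (x * w) k (low-x s)
        (trans (*-congˡ z≈) (solve 4 (λ x w a y → x :* (w :+ a :* y) := x :* w :+ a :* (x :* y)) refl x w a (x ^ d)))

      low-power : ∀ {d u} e → Low d u → Low (e ℕ.+ d) (x ^ e * u)
      low-power zero s = span-resp (sym (*-identityˡ _)) s
      low-power {u = u} (suc e) s = span-resp (sym (*-assoc x (x ^ e) u)) (low-x (low-power e s))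

      low-* : ∀ {d e u v} → Low d u → Low e v → Low (d ℕ.+ e) (u * v)
      low-* {zero} {v = v} (nil z≈0) t = span-resp (trans (sym (zeroˡ v)) (*-congʳ (sym z≈0))) (span-0 int-0 _)
      low-* {suc d} {e} {v = v} (cons a w k s z≈) t = span-resp
        (trans (solve 4 (λ w v a y → w :* v :+ a :* (y :* v) := (w :+ a :* y) :* v) refl w v a (x ^ d)) (*-congʳ (sym z≈)))
        (low-+ (low-suc (low-* s t)) (low-suc (low-scale k (low-power d t))))

      monic-*-low : ∀ {d e p u} → Monic d p → Low e u → Low (d ℕ.+ e) (p * u)
      monic-*-low {d} {u = u} (w , s , p≈) t = span-resp
        (trans (sym (distribʳ u (x ^ d) w)) (*-congʳ (sym p≈)))
        (low-+ (low-power d t) (low-* s t))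

      monic-* : ∀ {d e p q} → Monic d p → Monic e q → Monic (d ℕ.+ e) (p * q)
      monic-* {d} {e} {p} {q} m@(w , s , p≈) (v , t , q≈) =
        x ^ e * w + p * v ,
        low-+ (≡.subst (λ n → Low n (x ^ e * w)) (ℕ.+-comm e d) (low-power e s)) (monic-*-low m t) ,
        (begin
          p * q                                  ≈⟨ *-congˡ q≈ ⟩
          p * (x ^ e + v)                        ≈⟨ distribˡ p (x ^ e) v ⟩
          p * x ^ e + p * v                      ≈⟨ +-congʳ (*-congʳ p≈) ⟩
          (x ^ d + w) * x ^ e + p * v            ≈⟨ solve 4 (λ y w z r → (y :+ w) :* z :+ r := y :* z :+ (z :* w :+ r)) refl (x ^ d) w (x ^ e) (p * v) ⟩
          x ^ d * x ^ e + (x ^ e * w + p * v)    ≈⟨ +-congʳ (sym (^-homo-* x d e)) ⟩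
          x ^ (d ℕ.+ e) + (x ^ e * w + p * v)    ∎)
        where open import Algebra.Properties.Semiring.Exp semiring using (^-homo-*)

      monic-minus : ∀ {d p u} → Monic d p → Low d u → Monic d (p - u)
      monic-minus {d} {p} {u} (w , s , p≈) t = w + - 1# * u , low-+ s (low-scale int--1 t) ,
        trans (+-cong p≈ (sym (-1*x≈-x u))) (+-assoc (x ^ d) w (- 1# * u))

      eliminate : ∀ vs {d p} → Monic d p → All (λ v → Span (Low d) vs (p * v)) vs →
                  ∃₂ λ e r → Monic e r × All (λ v → r * v ≈ 0#) vs
      eliminate [] m [] = _ , _ , m , []
      eliminate (v₀ ∷ vs) {d} {p} m (cons c₀ w₀ low₀ s₀ e₀ ∷ rows) =
        let e , r , monic , kills = eliminate vs (monic-* m m′) (All.map row rows) in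
        e ℕ.+ d , r * q , monic-* monic m′ ,
        trans (*-assoc r q v₀) (trans (*-congˡ qv₀≈w₀) (span-annihilated kills s₀)) ∷
        All.map (λ {v} rv≈0 → trans (solve 3 (λ r q v → r :* q :* v := q :* (r :* v)) refl r q v)
                                 (trans (*-congˡ rv≈0) (zeroʳ q))) kills
        where
        q : Carrier
        q = p - c₀

        m′ : Monic d q
        m′ = monic-minus m low₀

        qv₀≈w₀ : q * v₀ ≈ w₀
        qv₀≈w₀ = begin
          (p - c₀) * v₀                    ≈⟨ distribʳ v₀ p (- c₀) ⟩
          p * v₀ + - c₀ * v₀               ≈⟨ +-congʳ e₀ ⟩
          w₀ + c₀ * v₀ + - c₀ * v₀         ≈⟨ solve 4 (λ w c n v → w :+ c :* v :+ n :* v := w :+ (c :+ n) :* v) refl w₀ c₀ (- c₀) v₀ ⟩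
          w₀ + (c₀ + - c₀) * v₀            ≈⟨ +-congˡ (*-congʳ (-‿inverseʳ c₀)) ⟩
          w₀ + 0# * v₀                     ≈⟨ solve 2 (λ w v → w :+ con 0 :* v := w) refl w₀ v₀ ⟩
          w₀                               ∎

        row : ∀ {v} → Span (Low d) (v₀ ∷ vs) (p * v) → Span (Low (d ℕ.+ d)) vs (p * q * v)
        row {v} (cons b w low s eq) = span-resp
          (begin
            q * w + b * w₀         ≈⟨ +-congˡ (*-congˡ (sym qv₀≈w₀)) ⟩
            q * w + b * (q * v₀)   ≈⟨ solve 4 (λ q w b v₀ → q :* w :+ b :* (q :* v₀) := q :* (w :+ b :* v₀)) refl q w b v₀ ⟩
            q * (w + b * v₀)       ≈⟨ *-congˡ (sym eq) ⟩
            q * (p * v)            ≈⟨ solve 3 (λ q p v → q :* (p :* v) := p :* q :* v) refl q p v ⟩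
            p * q * v              ∎)
          (span-+ low-+ (span-scale q (monic-*-low m′) s) (span-scale b (low-* low) s₀))

      snoc : ∀ {n} → Vector ℤ n → ℤ → Vector ℤ (suc n)
      snoc {zero}  a k _           = k
      snoc {suc n} a k Fin.zero    = a Fin.zero
      snoc {suc n} a k (Fin.suc i) = snoc (a ∘ Fin.suc) k i

      sum-snoc : ∀ {n} (a : Vector ℤ n) k (g : ℕ → Carrier) →
        ∑[ i < suc n ] (φ (snoc a k i) * g (toℕ i)) ≈ ∑[ i < n ] (φ (a i) * g (toℕ i)) + φ k * g n
      sum-snoc {zero}  a k g = +-comm _ _
      sum-snoc {suc n} a k g = trans (+-congˡ (sum-snoc (a ∘ Fin.suc) k (g ∘ suc))) (sym (+-assoc _ _ _))

      low⇒sum : ∀ {d u} → Low d u → ∃ λ (a : Vector ℤ d) → u ≈ ∑[ i < d ] (φ (a i) * x ^ toℕ i)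
      low⇒sum {zero} (nil z≈0) = (λ ()) , z≈0
      low⇒sum {suc d} (cons b w (k , b≈) s z≈) =
        let a , w≈ = low⇒sum s in
        snoc a k , trans z≈ (trans (+-cong w≈ (*-congʳ b≈)) (sym (sum-snoc a k (x ^_))))

      sum⇒low : ∀ {d} (a : Vector ℤ d) → Low d (∑[ i < d ] (φ (a i) * x ^ toℕ i))
      sum⇒low {zero}  a = nil refl
      sum⇒low {suc d} a = cons (φ (a (fromℕ d))) _ (_ , refl) (sum⇒low (a ∘ inject₁))
        (trans (sum-init-last (λ i → φ (a i) * x ^ toℕ i))
          (+-cong (sum-cong-≋ {d} (λ i → *-congˡ (reflexive (≡.cong (x ^_) (Fin.toℕ-inject₁ i)))))
                  (*-congˡ (reflexive (≡.cong (x ^_) (Fin.toℕ-fromℕ d))))))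

      integral⇒monic : Integral x → ∃ λ d → Monic d 0#
      integral⇒monic (d , a , e) = d , _ , sum⇒low a , sym e

      monic⇒integral : ∀ {d} → Monic d 0# → Integral x
      monic⇒integral {d} (w , s , e) = let a , w≈ = low⇒sum s in
        d , a , trans (+-congˡ (sym w≈)) (sym e)

      stable⇒integral : ∀ vs → Span Int vs 1# → All (λ v → Span Int vs (x * v)) vs → Integral x
      stable⇒integral vs s rows =
        let e , r , (w , low , r≈) , kills = eliminate vs monic-x (All.map (span-map low-const) rows)
            r≈0 = trans (sym (*-identityʳ r)) (span-annihilated kills s)
        in monic⇒integral (w , low , trans (sym r≈0) r≈)
        where
        monic-x : Monic 1 x
        monic-x = 0# , span-0 int-0 _ , solve 1 (λ x → x := x :* con 1 :+ con 0) refl x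

      low-powers : ∀ d → All (Low d) (powers x d)
      low-powers zero    = []
      low-powers (suc d) = cons 1# 0# int-1 (span-0 int-0 _) (solve 1 (λ y → y := con 0 :+ con 1 :* y) refl (x ^ d))
        ∷ All.map low-suc (low-powers d)

      reduce : ∀ {d u} → Monic d 0# → Low (suc d) u → Low d u
      reduce {d} {u} (w₀ , s₀ , e₀) (cons a w k s u≈) = span-resp
        (begin
          w + a * (- 1# * w₀)                    ≈⟨ +-congˡ (*-congˡ (+-identityˡ _)) ⟨
          w + a * (0# + - 1# * w₀)               ≈⟨ +-congˡ (*-congˡ (+-congʳ e₀)) ⟩
          w + a * (x ^ d + w₀ + - 1# * w₀)       ≈⟨ solve 5 (λ w a y w₀ n → w :+ a :* (y :+ w₀ :+ n :* w₀) := w :+ a :* (y :+ (con 1 :+ n) :* w₀)) refl w a (x ^ d) w₀ (- 1#) ⟩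
          w + a * (x ^ d + (1# + - 1#) * w₀)     ≈⟨ +-congˡ (*-congˡ (+-congˡ (*-congʳ (-‿inverseʳ 1#)))) ⟩
          w + a * (x ^ d + 0# * w₀)              ≈⟨ solve 4 (λ w a y w₀ → w :+ a :* (y :+ con 0 :* w₀) := w :+ a :* y) refl w a (x ^ d) w₀ ⟩
          w + a * x ^ d                          ≈⟨ u≈ ⟨
          u                                      ∎)
        (low-+ s (low-scale k (low-scale int--1 s₀)))

      low-1 : ∀ {d} → Monic d 0# → Low d 1#
      low-1 {d} m = reduce m (≡.subst (λ n → Low n 1#) (ℕ.+-comm d 1) (low-weaken d (low-const int-1)))

    open Powers using (Low; Monic)

    tensor : List Carrier → List Carrier → List Carrier
    tensor us []       = []
    tensor us (y ∷ ys) = List.map (y *_) us ++ tensor us ys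

    span-tensor : ∀ {us ys u y} → Span Int us u → Span Int ys y → Span Int (tensor us ys) (u * y)
    span-tensor {u = u} s (nil y≈0) = nil (trans (*-congˡ y≈0) (zeroʳ u))
    span-tensor {ys = v ∷ _} {u} {y} s (cons b w k t y≈) = span-resp
      (begin
        b * (v * u) + u * w    ≈⟨ solve 4 (λ b v u w → b :* (v :* u) :+ u :* w := u :* (w :+ b :* v)) refl b v u w ⟩
        u * (w + b * v)        ≈⟨ *-congˡ y≈ ⟨
        u * y                  ∎)
      (span-++ (span-scale b (int-* k) (span-generators v s)) (span-tensor s t))

    all-tensor : ∀ {p q r} {P : Pred Carrier p} {Q : Pred Carrier q} {T : Pred Carrier r} {us ys} →
                 (∀ {u y} → P u → Q y → T (y * u)) → All P us → All Q ys → All T (tensor us ys)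
    all-tensor f ps []       = []
    all-tensor f ps (q ∷ qs) = All.++⁺ (All.map⁺ (All.map (λ p → f p q) ps)) (all-tensor f ps qs)

    module Pair {x y} (x-int : Integral x) (y-int : Integral y) where
      m n : ℕ
      m = proj₁ x-int
      n = proj₁ y-int
      x-monic : Monic x m 0#
      x-monic = proj₂ (Powers.integral⇒monic x x-int)
      y-monic : Monic y n 0#
      y-monic = proj₂ (Powers.integral⇒monic y y-int)

      generators : List Carrier
      generators = tensor (powers x m) (powers y n)

      span-1 : Span Int generators 1#
      span-1 = span-resp (*-identityˡ 1#) (span-tensor (Powers.low-1 x x-monic) (Powers.low-1 y y-monic))

      stable : ∀ z → (∀ {u v} → Low x m u → Low y n v → Span Int generators (z * (v * u))) → Integral z
      stable z f = Powers.stable⇒integral z generators span-1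
        (all-tensor f (Powers.low-powers x m) (Powers.low-powers y n))

      times-x : ∀ {u} → Low x m u → Low x m (x * u)
      times-x s = Powers.reduce x x-monic (Powers.low-x x s)

      times-y : ∀ {v} → Low y n v → Low y n (y * v)
      times-y s = Powers.reduce y y-monic (Powers.low-x y s)

  abstract
    integral-+ : ∀ {x y} → Integral x → Integral y → Integral (x + y)
    integral-+ {x} {y} x-int y-int = stable (x + y) λ {u} {v} s t → span-resp
      (solve 4 (λ x y u v → (x :* u) :* v :+ u :* (y :* v) := (x :+ y) :* (v :* u)) refl x y u v)
      (span-+ int-+ (span-tensor (times-x s) t) (span-tensor s (times-y t)))
      where open Pair x-int y-int

    integral-* : ∀ {x y} → Integral x → Integral y → Integral (x * y)
    integral-* {x} {y} x-int y-int = stable (x * y) λ {u} {v} s t → span-resp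
      (solve 4 (λ x y u v → (x :* u) :* (y :* v) := (x :* y) :* (v :* u)) refl x y u v)
      (span-tensor (times-x s) (times-y t))
      where open Pair x-int y-int

    integral-resp : ∀ {x y} → x ≈ y → Integral x → Integral y
    integral-resp x≈y (n , a , e) = n , a , trans
      (sym (+-cong (^-congˡ n x≈y) (sum-cong-≋ {n} (λ i → *-congˡ (^-congˡ (toℕ i) x≈y))))) e
      where open import Algebra.Properties.Semiring.Exp semiring using (^-congˡ)

    integral-0 : Integral 0#
    integral-0 = 1 , (λ _ → ℤ.0ℤ) , trans (+-congˡ (+-congʳ (*-congʳ φ.0#-homo)))
      (solve 0 (con 0 :* con 1 :+ (con 0 :* con 1 :+ con 0) := con 0) refl)

    integral-1 : Integral 1#
    integral-1 = 1 , (λ _ → ℤ.- ℤ.1ℤ) , (begin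
      1# * 1# + (φ (ℤ.- ℤ.1ℤ) * 1# + 0#)  ≈⟨ +-cong (*-identityˡ 1#) (trans (+-identityʳ _) (*-identityʳ _)) ⟩
      1# + φ (ℤ.- ℤ.1ℤ)                   ≈⟨ +-congˡ (trans (φ.-‿homo ℤ.1ℤ) (-‿cong φ.1#-homo)) ⟩
      1# + - 1#                           ≈⟨ -‿inverseʳ 1# ⟩
      0#                                  ∎)

record Unit {c ℓ} (M : CommutativeMonoid c ℓ) : Set (c ⊔ ℓ) where
  open CommutativeMonoid M
  field
    elem    : Carrier
    inv     : Carrier
    inverse : elem ∙ inv ≈ ε

unitGroup : ∀ {c ℓ} → CommutativeMonoid c ℓ → AbelianGroup (c ⊔ ℓ) ℓ
unitGroup M = record
  { Carrier = Unit M
  ; _≈_ = λ u v → elem u ≈ elem v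
  ; _∙_ = λ u v → record
    { elem = elem u ∙ elem v
    ; inv = inv u ∙ inv v
    ; inverse = trans (interchange (elem u) (elem v) (inv u) (inv v))
                      (trans (∙-cong (inverse u) (inverse v)) (identityˡ ε))
    }
  ; ε = record { elem = ε ; inv = ε ; inverse = identityˡ ε }
  ; _⁻¹ = λ u → record { elem = inv u ; inv = elem u ; inverse = inverseˡ u }
  ; isAbelianGroup = record
    { isGroup = record
      { isMonoid = record
        { isSemigroup = record
          { isMagma = record
            { isEquivalence = record { refl = refl ; sym = sym ; trans = trans }
            ; ∙-cong = ∙-cong
            }
          ; assoc = λ u v w → assoc (elem u) (elem v) (elem w)
          }
        ; identity = identityˡ ∘ elem , identityʳ ∘ elem
        }
      ; inverse = inverseˡ , inverse
      ; ⁻¹-cong = λ {u} {v} u≈v → begin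
          inv u                      ≈⟨ identityʳ _ ⟨
          inv u ∙ ε                  ≈⟨ ∙-congˡ (inverse v) ⟨
          inv u ∙ (elem v ∙ inv v)   ≈⟨ assoc _ _ _ ⟨
          inv u ∙ elem v ∙ inv v     ≈⟨ ∙-congʳ (∙-congˡ u≈v) ⟨
          inv u ∙ elem u ∙ inv v     ≈⟨ ∙-congʳ (inverseˡ u) ⟩
          ε ∙ inv v                  ≈⟨ identityˡ _ ⟩
          inv v                      ∎
      }
    ; comm = λ u v → comm (elem u) (elem v)
    }
  }
  where
  open CommutativeMonoid M
  open Unit
  open import Algebra.Properties.CommutativeSemigroup commutativeSemigroup using (interchange)
  open import Relation.Binary.Reasoning.Setoid setoid

  inverseˡ : ∀ u → inv u ∙ elem u ≈ ε
  inverseˡ u = trans (comm (inv u) (elem u)) (inverse u)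

module _ {c ℓ} (M : CommutativeMonoid c ℓ) where
  open CommutativeMonoid M

  ∏ : ∀ {n} → Vector Carrier n → Carrier
  ∏ = Sum.sum M

  power : ℕ → Carrier → Carrier
  power = Mult._×_ M

  factor-unit : ∀ {n} (x : Vector Carrier n) (e : Vector ℕ n) (u : Unit M) →
    Unit.elem u ≈ ∏ (λ i → power (e i) (x i)) → ∀ i → 0 ℕ.< e i → Unit M
  factor-unit {suc n} x e u eq i 0<e = record
    { elem = x i
    ; inv = power k (x i) ∙ rest ∙ Unit.inv u
    ; inverse = begin
        x i ∙ (power k (x i) ∙ rest ∙ Unit.inv u)   ≈⟨ assoc _ _ _ ⟨
        x i ∙ (power k (x i) ∙ rest) ∙ Unit.inv u   ≈⟨ ∙-congʳ (assoc _ _ _) ⟨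
        power (suc k) (x i) ∙ rest ∙ Unit.inv u     ≡⟨ ≡.cong (λ m → power m (x i) ∙ rest ∙ Unit.inv u) 1+k≡e ⟩
        power (e i) (x i) ∙ rest ∙ Unit.inv u       ≈⟨ ∙-congʳ (Sum.sum-remove M {i = i} powers) ⟨
        ∏ powers ∙ Unit.inv u                     ≈⟨ ∙-congʳ eq ⟨
        Unit.elem u ∙ Unit.inv u                    ≈⟨ Unit.inverse u ⟩
        ε                                           ∎
    }
    where
    open import Relation.Binary.Reasoning.Setoid setoid
    powers : Vector Carrier (suc n)
    powers j = power (e j) (x j)
    rest : Carrier
    rest = ∏ (Vector.removeAt powers i)
    k : ℕ
    k = ℕ.pred (e i)
    1+k≡e : suc k ≡ e i
    1+k≡e = ℕ.suc-pred (e i) {{ℕ.>-nonZero 0<e}}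

ℂˣ : AbelianGroup 0ℓ 0ℓ
ℂˣ = unitGroup (CommutativeRing.*-commutativeMonoid ℂ-commutativeRing)

record Character {g₁ g₂} (G : Group g₁ g₂) : Set (g₁ ⊔ g₂) where
  field
    apply               : Group.Carrier G → AbelianGroup.Carrier ℂˣ
    isGroupHomomorphism : IsGroupHomomorphism (Group.rawGroup G) (AbelianGroup.rawGroup ℂˣ) apply

  value : Group.Carrier G → ℂ
  value x = Unit.elem (apply x)

dual : ∀ {g₁ g₂} → Group g₁ g₂ → Setoid (g₁ ⊔ g₂) g₁
dual G = record
  { Carrier = Character G
  ; _≈_ = λ χ ψ → ∀ x → value χ x ≈ℂ value ψ x
  ; isEquivalence = record
    { refl = λ x → refl
    ; sym = λ p x → sym (p x)
    ; trans = λ p q x → trans (p x) (q x)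
    }
  }
  where
  open Character
  open CommutativeRing ℂ-commutativeRing using (refl; sym; trans)

Finite : ∀ {a ℓ} → Setoid a ℓ → Set (a ⊔ ℓ)
Finite S = ∃ λ n → Inverse (≡.setoid (Fin n)) S

fromℤ : ℤ → ℚ
fromℤ k = k ℚ./ 1

fromℤ-isRingHomomorphism : IsRingHomomorphism ℤ.+-*-rawRing ℚ.+-*-rawRing fromℤ
fromℤ-isRingHomomorphism = record
  { isSemiringHomomorphism = record
    { isNearSemiringHomomorphism = record
      { +-isMonoidHomomorphism = record
        { isMagmaHomomorphism = record
          { isRelHomomorphism = record { cong = ≡.cong fromℤ }
          ; homo = λ j k → ℚ.toℚᵘ-injective (begin
              ℚ.toℚᵘ (fromℤ (j ℤ.+ k))                     ≈⟨ ℚ.toℚᵘ-fromℚᵘ (ℚᵘ.mkℚᵘ (j ℤ.+ k) 0) ⟩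
              ℚᵘ.mkℚᵘ (j ℤ.+ k) 0                          ≈⟨ ℚᵘ.*≡* (≡.cong (ℤ._* ℤ.1ℤ) (≡.sym (≡.cong₂ ℤ._+_ (ℤ.*-identityʳ j) (ℤ.*-identityʳ k)))) ⟩
              ℚᵘ.mkℚᵘ j 0 ℚᵘ.+ ℚᵘ.mkℚᵘ k 0                 ≈⟨ ℚᵘ.+-cong (ℚ.toℚᵘ-fromℚᵘ (ℚᵘ.mkℚᵘ j 0)) (ℚ.toℚᵘ-fromℚᵘ (ℚᵘ.mkℚᵘ k 0)) ⟨
              ℚ.toℚᵘ (fromℤ j) ℚᵘ.+ ℚ.toℚᵘ (fromℤ k)       ≈⟨ ℚ.toℚᵘ-homo-+ (fromℤ j) (fromℤ k) ⟨
              ℚ.toℚᵘ (fromℤ j ℚ.+ fromℤ k)                 ∎)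
          }
        ; ε-homo = ≡.refl
        }
      ; *-homo = λ j k → ℚ.toℚᵘ-injective (begin
          ℚ.toℚᵘ (fromℤ (j ℤ.* k))                         ≈⟨ ℚ.toℚᵘ-fromℚᵘ (ℚᵘ.mkℚᵘ (j ℤ.* k) 0) ⟩
          ℚᵘ.mkℚᵘ j 0 ℚᵘ.* ℚᵘ.mkℚᵘ k 0                     ≈⟨ ℚᵘ.*-cong (ℚ.toℚᵘ-fromℚᵘ (ℚᵘ.mkℚᵘ j 0)) (ℚ.toℚᵘ-fromℚᵘ (ℚᵘ.mkℚᵘ k 0)) ⟨
          ℚ.toℚᵘ (fromℤ j) ℚᵘ.* ℚ.toℚᵘ (fromℤ k)           ≈⟨ ℚ.toℚᵘ-homo-* (fromℤ j) (fromℤ k) ⟨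
          ℚ.toℚᵘ (fromℤ j ℚ.* fromℤ k)                     ∎)
      }
    ; 1#-homo = ≡.refl
    }
  ; -‿homo = λ k → ℚ.toℚᵘ-injective (begin
      ℚ.toℚᵘ (fromℤ (ℤ.- k))     ≈⟨ ℚ.toℚᵘ-fromℚᵘ (ℚᵘ.mkℚᵘ (ℤ.- k) 0) ⟩
      ℚᵘ.- ℚᵘ.mkℚᵘ k 0           ≈⟨ ℚᵘ.-‿cong (ℚ.toℚᵘ-fromℚᵘ (ℚᵘ.mkℚᵘ k 0)) ⟨
      ℚᵘ.- ℚ.toℚᵘ (fromℤ k)      ≈⟨ ℚ.toℚᵘ-homo‿- (fromℤ k) ⟨
      ℚ.toℚᵘ (ℚ.- fromℤ k)       ∎)
  }
  where open import Relation.Binary.Reasoning.Setoid ℚᵘ.≃-setoid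

module _ {c ℓ₁ ℓ₂} (K : HeytingField c ℓ₁ ℓ₂) where

  open HeytingField K using (Carrier; _≈_; _*_; 0#; heytingCommutativeRing)
  open HeytingCommutativeRing heytingCommutativeRing using (commutativeRing)
  open CommutativeRing commutativeRing using (rawRing; semiring)
  open import Algebra.Properties.Semiring.Sum semiring using (sum-syntax)

  record IsNumberField : Set (c ⊔ ℓ₁) where
    field
      ι                    : ℚ → Carrier
      ι-isRingHomomorphism : IsRingHomomorphism ℚ.+-*-rawRing rawRing ι
      degree               : ℕ
      basis                : Vector Carrier degree
      spanning             : ∀ x → ∃ λ (q : Vector ℚ degree) → x ≈ ∑[ i < degree ] (ι (q i) * basis i)
      independent          : ∀ (q : Vector ℚ degree) → ∑[ i < degree ] (ι (q i) * basis i) ≈ 0# → ∀ i → q i ≡ 0ℚ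

module Arithmetic {c ℓ₁ ℓ₂} (K : HeytingField c ℓ₁ ℓ₂) (isNumberField : IsNumberField K) where

  open HeytingField K
  open HeytingCommutativeRing heytingCommutativeRing using (commutativeRing)
  open CommutativeRing commutativeRing using (*-commutativeSemigroup)
  open IsNumberField isNumberField using (ι; ι-isRingHomomorphism)
  open import Algebra.Apartness.Properties.HeytingCommutativeRing heytingCommutativeRing
    using (x#0y#0→xy#0; #-congʳ; x-0≈x; 1#0)
  open import Algebra.Properties.CommutativeSemigroup *-commutativeSemigroup
    using (interchange; x∙yz≈y∙xz)
  open Integrality commutativeRing (ι ∘ fromℤ)
    (Composition.isRingHomomorphism trans fromℤ-isRingHomomorphism ι-isRingHomomorphism)

  𝓞 : Pred Carrier ℓ₁
  𝓞 = Integral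

  -- 𝓞-submodules of K; ideals of 𝓞 are those contained in 𝓞.
  record Submodule : Set (lsuc (c ⊔ ℓ₁)) where
    field
      member : Pred Carrier (c ⊔ ℓ₁)
      resp   : ∀ {x y} → x ≈ y → x ∈ member → y ∈ member
      0∈     : 0# ∈ member
      +-∈    : ∀ {x y} → x ∈ member → y ∈ member → x + y ∈ member
      *-∈    : ∀ {a x} → a ∈ 𝓞 → x ∈ member → a * x ∈ member

  open Submodule

  infix 4 _≃_
  record _≃_ (I J : Submodule) : Set (c ⊔ ℓ₁) where
    constructor mk≃
    field
      equal : member I ≐ member J

  -- x𝓞, for any x ∈ K
  ⟨_⟩ : Carrier → Submodule
  ⟨ x ⟩ = record
    { member = λ z → ∃ λ a → a ∈ 𝓞 × z ≈ a * x
    ; resp = λ { y≈z (a , a∈𝓞 , y≈ax) → a , a∈𝓞 , trans (sym y≈z) y≈ax }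
    ; 0∈ = 0# , integral-0 , sym (zeroˡ x)
    ; +-∈ = λ { (a , a∈𝓞 , p) (b , b∈𝓞 , q) →
        a + b , integral-+ a∈𝓞 b∈𝓞 , trans (+-cong p q) (sym (distribʳ x a b)) }
    ; *-∈ = λ { {b} b∈𝓞 (a , a∈𝓞 , p) →
        b * a , integral-* b∈𝓞 a∈𝓞 , trans (*-congˡ p) (sym (*-assoc b a x)) }
    }

  -- Finite sums of products xy with x ∈ I and y ∈ J.
  data Products (I J : Submodule) : Pred Carrier (c ⊔ ℓ₁) where
    product : ∀ {x y z} → x ∈ member I → y ∈ member J → z ≈ x * y → Products I J z
    plus    : ∀ {x y z} → Products I J x → Products I J y → z ≈ x + y → Products I J z

  products-resp : ∀ {I J x y} → x ≈ y → Products I J x → Products I J y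
  products-resp x≈y (product p q e) = product p q (trans (sym x≈y) e)
  products-resp x≈y (plus p q e)    = plus p q (trans (sym x≈y) e)

  products-scale : ∀ {I J a x} → a ∈ 𝓞 → Products I J x → Products I J (a * x)
  products-scale {I} {a = a} a∈𝓞 (product {x} {y} p q e) =
    product (*-∈ I a∈𝓞 p) q (trans (*-congˡ e) (sym (*-assoc a x y)))
  products-scale {a = a} a∈𝓞 (plus {x} {y} p q e) =
    plus (products-scale a∈𝓞 p) (products-scale a∈𝓞 q) (trans (*-congˡ e) (distribˡ a x y))

  products-⊆ : ∀ {I J} (L : Submodule) →
    (∀ {x y} → x ∈ member I → y ∈ member J → x * y ∈ member L) → Products I J ⊆ member L
  products-⊆ L f (product p q e) = resp L (sym e) (f p q)
  products-⊆ L f (plus p q e)    = resp L (sym e) (+-∈ L (products-⊆ L f p) (products-⊆ L f q))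

  infixl 7 _·_
  _·_ : Submodule → Submodule → Submodule
  I · J = record
    { member = Products I J
    ; resp = products-resp
    ; 0∈ = product (0∈ I) (0∈ J) (sym (zeroˡ 0#))
    ; +-∈ = λ p q → plus p q refl
    ; *-∈ = products-scale
    }

  ·-mono : ∀ {I I′ J J′} → member I ⊆ member I′ → member J ⊆ member J′ → member (I · J) ⊆ member (I′ · J′)
  ·-mono {I′ = I′} {J′ = J′} f g = products-⊆ (I′ · J′) λ p q → product (f p) (g q) refl

  ·-comm-⊆ : ∀ I J → member (I · J) ⊆ member (J · I)
  ·-comm-⊆ I J = products-⊆ (J · I) λ {x} {y} p q → product q p (*-comm x y)

  -- {z | zw ∈ I}
  quotient : Carrier → Submodule → Submodule
  quotient w I = record
    { member = λ z → z * w ∈ member I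
    ; resp = λ e → resp I (*-congʳ e)
    ; 0∈ = resp I (sym (zeroˡ w)) (0∈ I)
    ; +-∈ = λ {x} {y} p q → resp I (sym (distribʳ w x y)) (+-∈ I p q)
    ; *-∈ = λ {a} {x} a∈𝓞 p → resp I (sym (*-assoc a x w)) (*-∈ I a∈𝓞 p)
    }

  ·-assoc-⊆ : ∀ I J L → member (I · J · L) ⊆ member (I · (J · L))
  ·-assoc-⊆ I J L = products-⊆ (I · (J · L)) λ {_} {w} p r →
    products-⊆ (quotient w (I · (J · L)))
      (λ {x} {y} i j → product i (product j r refl) (*-assoc x y w)) p

  ·-assoc-⊇ : ∀ I J L → member (I · (J · L)) ⊆ member (I · J · L)
  ·-assoc-⊇ I J L = ·-comm-⊆ L (I · J) ∘ ·-mono {L} {L} {J · I} {I · J} (λ p → p) (·-comm-⊆ J I) ∘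
    ·-assoc-⊆ L J I ∘ ·-mono {J · L} {L · J} {I} {I} (·-comm-⊆ J L) (λ p → p) ∘ ·-comm-⊆ I (J · L)

  ≃-refl : ∀ {I} → I ≃ I
  ≃-refl = mk≃ ((λ p → p) , (λ p → p))

  ≃-sym : ∀ {I J} → I ≃ J → J ≃ I
  ≃-sym (mk≃ (f , g)) = mk≃ (g , f)

  ≃-trans : ∀ {I J L} → I ≃ J → J ≃ L → I ≃ L
  ≃-trans (mk≃ (f , g)) (mk≃ (h , k)) = mk≃ (h ∘ f , g ∘ k)

  ·-cong : ∀ {I I′ J J′} → I ≃ I′ → J ≃ J′ → I · J ≃ I′ · J′
  ·-cong {I} {I′} {J} {J′} (mk≃ (f , g)) (mk≃ (h , k)) =
    mk≃ (·-mono {I} {I′} {J} {J′} f h , ·-mono {I′} {I} {J′} {J} g k)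

  ·-comm : ∀ I J → I · J ≃ J · I
  ·-comm I J = mk≃ (·-comm-⊆ I J , ·-comm-⊆ J I)

  ·-identityˡ : ∀ I → ⟨ 1# ⟩ · I ≃ I
  ·-identityˡ I = mk≃
    ( products-⊆ I (λ { {x} {y} (a , a∈𝓞 , x≈a1) q → resp I (*-congʳ (sym (trans x≈a1 (*-identityʳ a)))) (*-∈ I a∈𝓞 q) })
    , (λ {x} p → product (1# , integral-1 , sym (*-identityʳ 1#)) p (sym (*-identityˡ x))))

  ⟨⟩-· : ∀ x y → ⟨ x ⟩ · ⟨ y ⟩ ≃ ⟨ x * y ⟩
  ⟨⟩-· x y = mk≃
    ( products-⊆ ⟨ x * y ⟩ (λ { (a , a∈𝓞 , p) (b , b∈𝓞 , q) →
        a * b , integral-* a∈𝓞 b∈𝓞 , trans (*-cong p q) (interchange a x b y) })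
    , (λ { (a , a∈𝓞 , p) → product (a , a∈𝓞 , refl) (1# , integral-1 , sym (*-identityˡ y)) (trans p (sym (*-assoc a x y))) }))

  ⟨⟩-cong : ∀ {x y} → x ≈ y → ⟨ x ⟩ ≃ ⟨ y ⟩
  ⟨⟩-cong x≈y = mk≃
    ( (λ { (a , a∈𝓞 , p) → a , a∈𝓞 , trans p (*-congˡ x≈y) })
    , (λ { (a , a∈𝓞 , p) → a , a∈𝓞 , trans p (*-congˡ (sym x≈y)) }))

  submodules : CommutativeMonoid (lsuc (c ⊔ ℓ₁)) (c ⊔ ℓ₁)
  submodules = record
    { Carrier = Submodule
    ; _≈_ = _≃_
    ; _∙_ = _·_
    ; ε = ⟨ 1# ⟩
    ; isCommutativeMonoid = record
      { isMonoid = record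
        { isSemigroup = record
          { isMagma = record
            { isEquivalence = record { refl = ≃-refl ; sym = ≃-sym ; trans = ≃-trans }
            ; ∙-cong = ·-cong
            }
          ; assoc = λ I J L → mk≃ (·-assoc-⊆ I J L , ·-assoc-⊇ I J L)
          }
        ; identity = ·-identityˡ , λ I → ≃-trans (·-comm I ⟨ 1# ⟩) (·-identityˡ I)
        }
      ; comm = ·-comm
      }
    }

  module S where
    open CommutativeMonoid submodules public
    open import Algebra.Properties.CommutativeSemigroup commutativeSemigroup public
      using (interchange; x∙yz≈y∙xz)

  record FractionalIdeal : Set (lsuc (c ⊔ ℓ₁) ⊔ ℓ₂) where
    field
      submodule     : Submodule
      denominator   : Carrier
      denominator∈𝓞 : denominator ∈ 𝓞
      denominator#0 : denominator # 0#
      cleared       : ∀ {x} → x ∈ member submodule → denominator * x ∈ 𝓞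

  open FractionalIdeal

  fractionalIdeals : CommutativeMonoid (lsuc (c ⊔ ℓ₁) ⊔ ℓ₂) (c ⊔ ℓ₁)
  fractionalIdeals = record
    { Carrier = FractionalIdeal
    ; _≈_ = λ I J → submodule I ≃ submodule J
    ; _∙_ = λ I J → record
      { submodule = submodule I · submodule J
      ; denominator = denominator I * denominator J
      ; denominator∈𝓞 = integral-* (denominator∈𝓞 I) (denominator∈𝓞 J)
      ; denominator#0 = x#0y#0→xy#0 (denominator#0 I) (denominator#0 J)
      ; cleared = products-cleared I J
      }
    ; ε = record
      { submodule = ⟨ 1# ⟩
      ; denominator = 1#
      ; denominator∈𝓞 = integral-1
      ; denominator#0 = 1#0
      ; cleared = λ { (a , a∈𝓞 , p) → integral-resp (sym (trans (*-identityˡ _) (trans p (*-identityʳ a)))) a∈𝓞 }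
      }
    ; isCommutativeMonoid = record
      { isMonoid = record
        { isSemigroup = record
          { isMagma = record
            { isEquivalence = record { refl = S.refl ; sym = S.sym ; trans = S.trans }
            ; ∙-cong = S.∙-cong
            }
          ; assoc = λ I J L → S.assoc (submodule I) (submodule J) (submodule L)
          }
        ; identity = S.identityˡ ∘ submodule , S.identityʳ ∘ submodule
        }
      ; comm = λ I J → S.comm (submodule I) (submodule J)
      }
    }
    where
    products-cleared : ∀ I J {z} → Products (submodule I) (submodule J) z →
      denominator I * denominator J * z ∈ 𝓞
    products-cleared I J (product {x} {y} p q e) = integral-resp
      (sym (trans (*-congˡ e) (interchange (denominator I) (denominator J) x y)))
      (integral-* (cleared I p) (cleared J q))
    products-cleared I J (plus p q e) = integral-resp
      (sym (trans (*-congˡ e) (distribˡ _ _ _)))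
      (integral-+ (products-cleared I J p) (products-cleared I J q))

  record Ideal : Set (lsuc (c ⊔ ℓ₁)) where
    field
      submodule : Submodule
      ⊆𝓞        : member submodule ⊆ 𝓞

  fractional : Ideal → FractionalIdeal
  fractional I = record
    { submodule = Ideal.submodule I
    ; denominator = 1#
    ; denominator∈𝓞 = integral-1
    ; denominator#0 = 1#0
    ; cleared = λ p → integral-resp (sym (*-identityˡ _)) (Ideal.⊆𝓞 I p)
    }

  IsPrincipalIdealDomain : Set (lsuc (c ⊔ ℓ₁))
  IsPrincipalIdealDomain = ∀ (I : Ideal) → ∃ λ a → a ∈ 𝓞 × Ideal.submodule I ≃ ⟨ a ⟩

  record IsPrime (P : Ideal) : Set (c ⊔ ℓ₁) where
    private member-P = member (Ideal.submodule P)
    field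
      proper : ¬ 1# ∈ member-P
      prime  : ∀ {a b} → a ∈ 𝓞 → b ∈ 𝓞 → a * b ∈ member-P → a ∈ member-P ⊎ b ∈ member-P

  -- In a Dedekind domain the invertible fractional ideals are exactly the nonzero ones.
  InvertibleIdeal : Set (lsuc (c ⊔ ℓ₁) ⊔ ℓ₂)
  InvertibleIdeal = Unit fractionalIdeals

  module Invertible = AbelianGroup (unitGroup fractionalIdeals)

  ∣_∣ : InvertibleIdeal → Submodule
  ∣ I ∣ = submodule (Unit.elem I)

  -- Ideal classes: I and J are equivalent when aI = bJ for nonzero a, b ∈ 𝓞.
  infix 4 _∼_
  record _∼_ (I J : InvertibleIdeal) : Set (c ⊔ ℓ₁ ⊔ ℓ₂) where
    field
      {a b} : Carrier
      a∈𝓞   : a ∈ 𝓞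
      b∈𝓞   : b ∈ 𝓞
      a#0   : a # 0#
      b#0   : b # 0#
      aI≃bJ : ⟨ a ⟩ · submodule (Unit.elem I) ≃ ⟨ b ⟩ · submodule (Unit.elem J)

  ≈⇒∼ : ∀ {I J} → I Invertible.≈ J → I ∼ J
  ≈⇒∼ I≈J = record
    { a∈𝓞 = integral-1 ; b∈𝓞 = integral-1 ; a#0 = 1#0 ; b#0 = 1#0 ; aI≃bJ = ·-cong ≃-refl I≈J }

  ∼-sym : ∀ {I J} → I ∼ J → J ∼ I
  ∼-sym e = record
    { a∈𝓞 = b∈𝓞 ; b∈𝓞 = a∈𝓞 ; a#0 = b#0 ; b#0 = a#0 ; aI≃bJ = ≃-sym aI≃bJ }
    where open _∼_ e

  ∼-trans : ∀ {I J L} → I ∼ J → J ∼ L → I ∼ L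
  ∼-trans {I} {J} {L} e f = record
    { a∈𝓞 = integral-* f.a∈𝓞 e.a∈𝓞
    ; b∈𝓞 = integral-* e.b∈𝓞 f.b∈𝓞
    ; a#0 = x#0y#0→xy#0 f.a#0 e.a#0
    ; b#0 = x#0y#0→xy#0 e.b#0 f.b#0
    ; aI≃bJ = begin
        ⟨ f.a * e.a ⟩ · ∣ I ∣         ≈⟨ S.∙-congʳ (⟨⟩-· f.a e.a) ⟨
        ⟨ f.a ⟩ · ⟨ e.a ⟩ · ∣ I ∣     ≈⟨ S.assoc _ _ _ ⟩
        ⟨ f.a ⟩ · (⟨ e.a ⟩ · ∣ I ∣)   ≈⟨ S.∙-congˡ e.aI≃bJ ⟩
        ⟨ f.a ⟩ · (⟨ e.b ⟩ · ∣ J ∣)   ≈⟨ S.x∙yz≈y∙xz _ _ _ ⟩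
        ⟨ e.b ⟩ · (⟨ f.a ⟩ · ∣ J ∣)   ≈⟨ S.∙-congˡ f.aI≃bJ ⟩
        ⟨ e.b ⟩ · (⟨ f.b ⟩ · ∣ L ∣)   ≈⟨ S.assoc _ _ _ ⟨
        ⟨ e.b ⟩ · ⟨ f.b ⟩ · ∣ L ∣     ≈⟨ S.∙-congʳ (⟨⟩-· e.b f.b) ⟩
        ⟨ e.b * f.b ⟩ · ∣ L ∣         ∎
    }
    where
    module e = _∼_ e
    module f = _∼_ f
    open import Relation.Binary.Reasoning.Setoid S.setoid

  ∼-∙-cong : ∀ {I I′ J J′} → I ∼ I′ → J ∼ J′ → (I Invertible.∙ J) ∼ (I′ Invertible.∙ J′)
  ∼-∙-cong {I} {I′} {J} {J′} e f = record
    { a∈𝓞 = integral-* e.a∈𝓞 f.a∈𝓞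
    ; b∈𝓞 = integral-* e.b∈𝓞 f.b∈𝓞
    ; a#0 = x#0y#0→xy#0 e.a#0 f.a#0
    ; b#0 = x#0y#0→xy#0 e.b#0 f.b#0
    ; aI≃bJ = begin
        ⟨ e.a * f.a ⟩ · (∣ I ∣ · ∣ J ∣)            ≈⟨ S.∙-congʳ (⟨⟩-· e.a f.a) ⟨
        ⟨ e.a ⟩ · ⟨ f.a ⟩ · (∣ I ∣ · ∣ J ∣)        ≈⟨ S.interchange _ _ _ _ ⟩
        (⟨ e.a ⟩ · ∣ I ∣) · (⟨ f.a ⟩ · ∣ J ∣)      ≈⟨ S.∙-cong e.aI≃bJ f.aI≃bJ ⟩
        (⟨ e.b ⟩ · ∣ I′ ∣) · (⟨ f.b ⟩ · ∣ J′ ∣)    ≈⟨ S.interchange _ _ _ _ ⟩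
        ⟨ e.b ⟩ · ⟨ f.b ⟩ · (∣ I′ ∣ · ∣ J′ ∣)      ≈⟨ S.∙-congʳ (⟨⟩-· e.b f.b) ⟩
        ⟨ e.b * f.b ⟩ · (∣ I′ ∣ · ∣ J′ ∣)          ∎
    }
    where
    module e = _∼_ e
    module f = _∼_ f
    open import Relation.Binary.Reasoning.Setoid S.setoid

  ∼-⁻¹-cong : ∀ {I J} → I ∼ J → (I Invertible.⁻¹) ∼ (J Invertible.⁻¹)
  ∼-⁻¹-cong {I} {J} e = record
    { a∈𝓞 = b∈𝓞 ; b∈𝓞 = a∈𝓞 ; a#0 = b#0 ; b#0 = a#0
    ; aI≃bJ = begin
        ⟨ b ⟩ · I⁻¹                          ≈⟨ S.identityʳ _ ⟨
        ⟨ b ⟩ · I⁻¹ · ⟨ 1# ⟩                 ≈⟨ S.∙-congˡ (Unit.inverse J) ⟨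
        ⟨ b ⟩ · I⁻¹ · (∣ J ∣ · J⁻¹)          ≈⟨ S.interchange _ _ _ _ ⟩
        (⟨ b ⟩ · ∣ J ∣) · (I⁻¹ · J⁻¹)        ≈⟨ S.∙-congʳ aI≃bJ ⟨
        (⟨ a ⟩ · ∣ I ∣) · (I⁻¹ · J⁻¹)        ≈⟨ S.∙-congˡ (S.comm _ _) ⟩
        (⟨ a ⟩ · ∣ I ∣) · (J⁻¹ · I⁻¹)        ≈⟨ S.interchange _ _ _ _ ⟩
        ⟨ a ⟩ · J⁻¹ · (∣ I ∣ · I⁻¹)          ≈⟨ S.∙-congˡ (Unit.inverse I) ⟩
        ⟨ a ⟩ · J⁻¹ · ⟨ 1# ⟩                 ≈⟨ S.identityʳ _ ⟩
        ⟨ a ⟩ · J⁻¹                          ∎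
    }
    where
    open _∼_ e
    I⁻¹ J⁻¹ : Submodule
    I⁻¹ = ∣ I Invertible.⁻¹ ∣
    J⁻¹ = ∣ J Invertible.⁻¹ ∣
    open import Relation.Binary.Reasoning.Setoid S.setoid

  Cl : AbelianGroup (lsuc (c ⊔ ℓ₁) ⊔ ℓ₂) (c ⊔ ℓ₁ ⊔ ℓ₂)
  Cl = record
    { Carrier = InvertibleIdeal
    ; _≈_ = _∼_
    ; _∙_ = Invertible._∙_
    ; ε = Invertible.ε
    ; _⁻¹ = Invertible._⁻¹
    ; isAbelianGroup = record
      { isGroup = record
        { isMonoid = record
          { isSemigroup = record
            { isMagma = record
              { isEquivalence = record { refl = λ {I} → ≈⇒∼ {I} {I} S.refl ; sym = ∼-sym ; trans = ∼-trans }
              ; ∙-cong = ∼-∙-cong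
              }
            ; assoc = λ I J L → ≈⇒∼ (Invertible.assoc I J L)
            }
          ; identity = (λ I → ≈⇒∼ (Invertible.identityˡ I)) , (λ I → ≈⇒∼ (Invertible.identityʳ I))
          }
        ; inverse = (λ I → ≈⇒∼ (Invertible.inverseˡ I)) , (λ I → ≈⇒∼ (Invertible.inverseʳ I))
        ; ⁻¹-cong = ∼-⁻¹-cong
        }
      ; comm = λ I J → ≈⇒∼ (Invertible.comm I J)
      }
    }

  ∏ᴵ : ∀ {n} → Vector FractionalIdeal n → FractionalIdeal
  ∏ᴵ = ∏ fractionalIdeals

  infixr 8 _^ᴵ_
  _^ᴵ_ : FractionalIdeal → ℕ → FractionalIdeal
  I ^ᴵ n = power fractionalIdeals n I

  record PrimeFactorization (α : Carrier) : Set (lsuc (c ⊔ ℓ₁)) where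
    field
      g          : ℕ
      𝔭          : Vector Ideal g
      e          : Vector ℕ g
      prime      : ∀ i → IsPrime (𝔭 i)
      distinct   : ∀ {i j} → i ≢ j → ¬ Ideal.submodule (𝔭 i) ≃ Ideal.submodule (𝔭 j)
      positive   : ∀ i → 0 ℕ.< e i
      factorizes : ⟨ α ⟩ ≃ submodule (∏ᴵ (λ i → fractional (𝔭 i) ^ᴵ e i))

  module _ {α} (α∈𝓞 : α ∈ 𝓞) (α#0 : α # 0#) (F : PrimeFactorization α) where
    open PrimeFactorization F

    private
      α-invertible : ∃ λ α⁻¹ → α * α⁻¹ ≈ 1#
      α-invertible = let α⁻¹ , _ , αα⁻¹≈1 = #⇒invertible α#0 in
        α⁻¹ , trans (*-congʳ (sym (x-0≈x α))) αα⁻¹≈1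

      α⁻¹ : Carrier
      α⁻¹ = proj₁ α-invertible

      ⟨α⟩-unit : Unit fractionalIdeals
      ⟨α⟩-unit = record
        { elem = record
          { submodule = ⟨ α ⟩
          ; denominator = 1#
          ; denominator∈𝓞 = integral-1
          ; denominator#0 = 1#0
          ; cleared = λ { (a , a∈𝓞 , p) → integral-resp
              (sym (trans (*-identityˡ _) p)) (integral-* a∈𝓞 α∈𝓞) }
          }
        ; inv = record
          { submodule = ⟨ α⁻¹ ⟩
          ; denominator = α
          ; denominator∈𝓞 = α∈𝓞
          ; denominator#0 = α#0
          ; cleared = λ { (a , a∈𝓞 , p) → integral-resp
              (sym (trans (*-congˡ p) (trans (x∙yz≈y∙xz α a α⁻¹)
                (trans (*-congˡ (proj₂ α-invertible)) (*-identityʳ a))))) a∈𝓞 }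
          }
        ; inverse = S.trans (⟨⟩-· α α⁻¹) (⟨⟩-cong (proj₂ α-invertible))
        }

    -- [𝔭ᵢ], where 𝔭ᵢ is invertible because it divides the invertible ideal (α).
    class : Fin g → AbelianGroup.Carrier Cl
    class i = factor-unit fractionalIdeals (fractional ∘ 𝔭) e ⟨α⟩-unit factorizes i (positive i)

    -- (1/h) ∑_{χ ∈ Ĝ} ∏ᵢ ∑_{0 ≤ k ≤ eᵢ} χ([𝔭ᵢ])ᵏ; the finiteness proofs provide h = |G|
    -- and the enumeration of Ĝ over which the sum runs.
    characterCount : Finite (AbelianGroup.setoid Cl) → Finite (dual (AbelianGroup.group Cl)) → ℂ
    characterCount (h , G-enumeration) (m , Ĝ-enumeration) =
      ℚ⇒ℂ (ℤ.1ℤ ℚ./ h) *ℂ ∑[ j < m ] ∏ *-commutativeMonoid (λ i →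
        ∑[ k ≤ e i ] (value (Inverse.to Ĝ-enumeration j) (class i) ^ toℕ k))
      where
      instance
        h-nonZero : ℕ.NonZero h
        h-nonZero = Fin.nonZeroIndex (Inverse.from G-enumeration (AbelianGroup.ε Cl))
      open Character using (value)
      open CommutativeRing ℂ-commutativeRing using (semiring; *-commutativeMonoid)
      open import Algebra.Properties.Semiring.Sum semiring using (sum-syntax; sum⁺-syntax)
      open import Algebra.Properties.Semiring.Exp semiring using (_^_)

{-# OPTIONS --safe #-}

-- If an invertible fractional ideal I has denominator d, then dI is an ideal of 𝓞, so dI = (a)
-- when 𝓞 is a principal ideal domain, and a ≠ 0 because I is invertible. Hence I ∼ (1), so that
-- Cl(K) and its dual are trivial: h = 1, the only character is constantly 1, and the inner sums
-- are eᵢ + 1.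
module Submission where

open import Defs
open import Algebra.Apartness.Bundles using (HeytingCommutativeRing; HeytingField)
open import Algebra.Bundles using (AbelianGroup; CommutativeRing; Group)
import Algebra.Morphism.Construct.Composition as Composition
open import Algebra.Morphism.Structures using (IsGroupHomomorphism; IsRingHomomorphism)
open import Data.Fin.Base as Fin using (Fin; toℕ)
import Data.Fin.Properties as Fin
open import Data.Integer.Base using (+_)
open import Data.Nat.Base as ℕ using (ℕ; zero; suc)
open import Data.Nat.Properties as ℕ using (*-1-commutativeMonoid)
open import Data.Product.Base using (∃; _×_; _,_; proj₁; proj₂)
open import Data.Vec.Functional using (Vector)
open import Function.Base using (_∘_; const)
open import Function.Bundles using (Inverse)
open import Relation.Binary.Bundles using (Setoid)
open import Relation.Binary.PropositionalEquality.Core as ≡ using (_≡_)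
open import Relation.Nullary.Negation.Core using (contradiction)
open import Relation.Unary using (_∈_)

module _ {a ℓ} (S : Setoid a ℓ) where
  open Setoid S

  singleton-finite : ∀ x₀ → (∀ x → x ≈ x₀) → Finite S
  singleton-finite x₀ x≈x₀ = 1 , record
    { to = const x₀
    ; from = const Fin.zero
    ; to-cong = λ _ → refl
    ; from-cong = λ _ → ≡.refl
    ; inverse = (λ {x} _ → sym (x≈x₀ x)) , λ { {Fin.zero} _ → ≡.refl }
    }

  -- The character count is stated for arbitrary finiteness proofs, so every enumeration of a
  -- singleton must be shown to have length 1. Length 0 fails because `from x₀` would lie in
  -- `Fin 0`; for length at least 2, indices 0 and 1 enumerate equal elements, so `from` identifies
  -- them.
  singleton-size : ∀ x₀ → (∀ x → x ≈ x₀) → (fin : Finite S) → proj₁ fin ≡ 1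
  singleton-size x₀ x≈x₀ (zero , enum) with () ← Inverse.from enum x₀
  singleton-size x₀ x≈x₀ (1 , enum) = ≡.refl
  singleton-size x₀ x≈x₀ (suc (suc n) , enum) = contradiction 0≡1 Fin.0≢1+n
    where
    open Inverse enum
    0≡1 : Fin.zero {suc n} ≡ Fin.suc Fin.zero
    0≡1 = ≡.trans (≡.sym (strictlyInverseʳ _))
      (≡.trans (from-cong (trans (x≈x₀ _) (sym (x≈x₀ _)))) (strictlyInverseʳ _))

private
  module ℂᴿ = CommutativeRing ℂ-commutativeRing

module _ {g₁ g₂} (G : Group g₁ g₂) where
  open Character
  private module G = Group G

  -- Inhabits the dual: uniqueness of characters alone would also allow size 0.
  trivialCharacter : Character G
  trivialCharacter = record
    { apply = const (AbelianGroup.ε ℂˣ)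
    ; isGroupHomomorphism = record
      { isMonoidHomomorphism = record
        { isMagmaHomomorphism = record
          { isRelHomomorphism = record { cong = λ _ → ℂᴿ.refl }
          ; homo = λ _ _ → ℂᴿ.sym (ℂᴿ.*-identityˡ ℂᴿ.1#)
          }
        ; ε-homo = ℂᴿ.refl
        }
      ; ⁻¹-homo = λ _ → ℂᴿ.refl
      }
    }

  character-trivial : (∀ x → x G.≈ G.ε) → ∀ (χ : Character G) x → value χ x ≈ℂ ℂᴿ.1#
  character-trivial x≈ε χ x = ℂᴿ.trans (⟦⟧-cong (x≈ε x)) ε-homo
    where open IsGroupHomomorphism (isGroupHomomorphism χ)

open import Algebra.Properties.Semiring.Exp ℂᴿ.semiring using (_^_; ^-congˡ)
open import Algebra.Properties.Semiring.Mult ℂᴿ.semiring using (×1-homo-*) renaming (_×_ to _×ℂ_)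
open import Algebra.Properties.Semiring.Sum ℂᴿ.semiring
  using (sum-cong-≋; sum-replicate; sum⁺-syntax)
import Algebra.Properties.CommutativeMonoid.Sum ℂᴿ.*-commutativeMonoid as ∏ℂ

-- `ℕ⇒ℂ` passes through ℚ, whereas the general facts on sums and products concern the n-fold sum of
-- 1; this bridges the two.
ℕ⇒ℂ≈×1 : ∀ n → ℕ⇒ℂ n ≈ℂ n ×ℂ ℂᴿ.1#
ℕ⇒ℂ≈×1 zero    = ℂᴿ.refl
ℕ⇒ℂ≈×1 (suc n) = ℂᴿ.trans
  (pointwise (λ _ → IsRingHomomorphism.+-homo fromℤ-isRingHomomorphism (+ 1) (+ n)) , pointwise (λ _ → ≡.refl))
  (ℂᴿ.+-congˡ {ℂᴿ.1#} (ℕ⇒ℂ≈×1 n))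

∏-ℕ⇒ℂ : ∀ {n} (t : Vector ℕ n) → ∏ ℂᴿ.*-commutativeMonoid (ℕ⇒ℂ ∘ t) ≈ℂ ℕ⇒ℂ (∏ *-1-commutativeMonoid t)
∏-ℕ⇒ℂ {zero}  t = ℂᴿ.refl
∏-ℕ⇒ℂ {suc n} t = begin
  ℕ⇒ℂ t₀ *ℂ ∏ ℂᴿ.*-commutativeMonoid (ℕ⇒ℂ ∘ t ∘ Fin.suc)  ≈⟨ ℂᴿ.*-congˡ {ℕ⇒ℂ t₀} (∏-ℕ⇒ℂ (t ∘ Fin.suc)) ⟩
  ℕ⇒ℂ t₀ *ℂ ℕ⇒ℂ rest                                      ≈⟨ ℂᴿ.*-cong (ℕ⇒ℂ≈×1 t₀) (ℕ⇒ℂ≈×1 rest) ⟩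
  (t₀ ×ℂ ℂᴿ.1#) *ℂ (rest ×ℂ ℂᴿ.1#)                        ≈⟨ ×1-homo-* t₀ rest ⟨
  (t₀ ℕ.* rest) ×ℂ ℂᴿ.1#                                  ≈⟨ ℕ⇒ℂ≈×1 (t₀ ℕ.* rest) ⟨
  ℕ⇒ℂ (t₀ ℕ.* rest)                                       ∎
  where
  open import Relation.Binary.Reasoning.Setoid ℂᴿ.setoid
  t₀ rest : ℕ
  t₀ = t Fin.zero
  rest = ∏ *-1-commutativeMonoid (t ∘ Fin.suc)

1^n≈1 : ∀ n → ℂᴿ.1# ^ n ≈ℂ ℂᴿ.1#
1^n≈1 zero    = ℂᴿ.refl
1^n≈1 (suc n) = ℂᴿ.trans (ℂᴿ.*-identityˡ (ℂᴿ.1# ^ n)) (1^n≈1 n)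

∑-powers-of-1 : ∀ {z} n → z ≈ℂ ℂᴿ.1# → ∑[ k ≤ n ] (z ^ toℕ k) ≈ℂ ℕ⇒ℂ (n ℕ.+ 1)
∑-powers-of-1 {z} n z≈1 = begin
  ∑[ k ≤ n ] (z ^ toℕ k)  ≈⟨ sum-cong-≋ {suc n} (λ k → ℂᴿ.trans (^-congˡ (toℕ k) z≈1) (1^n≈1 (toℕ k))) ⟩
  ∑[ k ≤ n ] ℂᴿ.1#        ≈⟨ sum-replicate (suc n) ⟩
  suc n ×ℂ ℂᴿ.1#          ≈⟨ ℕ⇒ℂ≈×1 (suc n) ⟨
  -- The index k runs from 0 to n inclusive, hence n + 1 terms.
  ℕ⇒ℂ (suc n)             ≡⟨ ≡.cong ℕ⇒ℂ (ℕ.+-comm 1 n) ⟩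
  ℕ⇒ℂ (n ℕ.+ 1)           ∎
  where open import Relation.Binary.Reasoning.Setoid ℂᴿ.setoid

module _ {c ℓ₁ ℓ₂} (K : HeytingField c ℓ₁ ℓ₂) (isNumberField : IsNumberField K) where
  open HeytingField K
  open HeytingCommutativeRing heytingCommutativeRing using (commutativeRing)
  open import Algebra.Apartness.Properties.HeytingCommutativeRing heytingCommutativeRing
    using (#-congʳ; x-0≈x; invertibleʳ⇒#)
  open import Algebra.Properties.CommutativeSemigroup (CommutativeRing.*-commutativeSemigroup commutativeRing)
    using (xy∙z≈y∙xz)
  open Arithmetic K isNumberField
  open IsNumberField isNumberField using (ι; ι-isRingHomomorphism)
  open Integrality commutativeRing (ι ∘ fromℤ)
    (Composition.isRingHomomorphism trans fromℤ-isRingHomomorphism ι-isRingHomomorphism)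
    using (integral-resp; integral-1)
  open Submodule

  -- In a Heyting field, apartness from 0 amounts to invertibility, and if z inverts xy then yz
  -- inverts x. The inverses are phrased for differences from 0, hence the rewriting with `x-0≈x`.
  xy#0⇒x#0 : ∀ {x y} → x * y # 0# → x # 0#
  xy#0⇒x#0 {x} {y} xy#0 with z , _ , [xy-0]z≈1 ← #⇒invertible xy#0 = invertibleʳ⇒# (y * z ,
    trans (*-congʳ (x-0≈x x)) (trans (sym (*-assoc x y z))
      (trans (*-congʳ (sym (x-0≈x (x * y)))) [xy-0]z≈1)))

  -- A product of submodules consists of finite sums, but with a principal factor these collapse:
  -- the coefficient of a is absorbed into J, and the common factor a is pulled out of the sum.
  ⟨⟩·-⊆ : ∀ a (J : Submodule) {z} → z ∈ member (⟨ a ⟩ · J) → ∃ λ j → j ∈ member J × z ≈ a * j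
  ⟨⟩·-⊆ a J (product {y = y} (b , b∈𝓞 , x≈ba) y∈J z≈xy) =
    b * y , *-∈ J b∈𝓞 y∈J , trans z≈xy (trans (*-congʳ x≈ba) (xy∙z≈y∙xz b a y))
  ⟨⟩·-⊆ a J (plus p q z≈) with j , j∈J , x≈aj ← ⟨⟩·-⊆ a J p | k , k∈J , y≈ak ← ⟨⟩·-⊆ a J q =
    j + k , +-∈ J j∈J k∈J , trans z≈ (trans (+-cong x≈aj y≈ak) (sym (distribˡ a j k)))

  cleared-ideal : FractionalIdeal → Ideal
  cleared-ideal I = record
    { submodule = ⟨ I.denominator ⟩ · I.submodule
    ; ⊆𝓞 = λ z∈dI → let j , j∈I , z≈dj = ⟨⟩·-⊆ I.denominator I.submodule z∈dI in
        integral-resp (sym z≈dj) (I.cleared j∈I)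
    }
    where module I = FractionalIdeal I

  module _ (pid : IsPrincipalIdealDomain) where

    class-trivial : ∀ (I : InvertibleIdeal) → I ∼ Invertible.ε
    class-trivial I with a , a∈𝓞 , dI≃a ← pid (cleared-ideal (Unit.elem I)) = record
      -- The relation is witnessed by dI = (a)(1): the denominator d scales I, and the generator a
      -- scales the unit ideal.
      { a∈𝓞 = denominator∈𝓞
      ; b∈𝓞 = a∈𝓞
      ; a#0 = denominator#0
      ; b#0 = a#0
      ; aI≃bJ = S.trans dI≃a (S.sym (S.identityʳ ⟨ a ⟩))
      }
      where
      open FractionalIdeal (Unit.elem I) renaming (submodule to I′; denominator to d)
      open import Relation.Binary.Reasoning.Setoid S.setoid
      I⁻¹ : Submodule
      I⁻¹ = ∣ I Invertible.⁻¹ ∣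

      -- Multiplying dI = (a) by the inverse of I presents d as a multiple of a.
      d≃aI⁻¹ : ⟨ d ⟩ ≃ ⟨ a ⟩ · I⁻¹
      d≃aI⁻¹ = begin
        ⟨ d ⟩               ≈⟨ S.identityʳ _ ⟨
        ⟨ d ⟩ · ⟨ 1# ⟩      ≈⟨ S.∙-congˡ (Unit.inverse I) ⟨
        ⟨ d ⟩ · (I′ · I⁻¹)  ≈⟨ S.assoc _ _ _ ⟨
        ⟨ d ⟩ · I′ · I⁻¹    ≈⟨ S.∙-congʳ dI≃a ⟩
        ⟨ a ⟩ · I⁻¹         ∎

      d∈aI⁻¹ : d ∈ member (⟨ a ⟩ · I⁻¹)
      d∈aI⁻¹ = proj₁ (_≃_.equal d≃aI⁻¹) (1# , integral-1 , sym (*-identityˡ d))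

      -- The principal ideal hypothesis yields a generator without saying that it is nonzero; since
      -- d = aj and d is apart from 0, so is a.
      a#0 : a # 0#
      a#0 with j , _ , d≈aj ← ⟨⟩·-⊆ a I⁻¹ d∈aI⁻¹ = xy#0⇒x#0 (#-congʳ d≈aj denominator#0)

    private
      Ĝ = dual (AbelianGroup.group Cl)

    Cl-character-trivial : ∀ (χ : Character (AbelianGroup.group Cl)) I → Character.value χ I ≈ℂ ℂᴿ.1#
    Cl-character-trivial = character-trivial (AbelianGroup.group Cl) class-trivial

    module _ {α} (α∈𝓞 : α ∈ 𝓞) (α#0 : α # 0#) (F : PrimeFactorization α) where
      open PrimeFactorization F using (e; g)

      characterCount-trivial : (Cl-finite : Finite (AbelianGroup.setoid Cl)) (Ĝ-finite : Finite Ĝ) →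
        proj₁ Cl-finite ≡ 1 → proj₁ Ĝ-finite ≡ 1 →
        characterCount α∈𝓞 α#0 F Cl-finite Ĝ-finite ≈ℂ ℕ⇒ℂ (∏ *-1-commutativeMonoid (λ i → e i ℕ.+ 1))
      -- Once both sizes are replaced by 1, the factor 1/h computes to 1 and the sum over characters
      -- to one term plus 0, so the two identity laws leave only the product over i.
      characterCount-trivial (_ , _) (_ , Ĝ-enum) ≡.refl ≡.refl =
        ℂᴿ.trans (ℂᴿ.*-identityˡ _) (ℂᴿ.trans (ℂᴿ.+-identityʳ _) (ℂᴿ.trans
          (∏ℂ.sum-cong-≋ {g} (λ i → ∑-powers-of-1 (e i) (Cl-character-trivial χ (class α∈𝓞 α#0 F i))))
          (∏-ℕ⇒ℂ (λ i → e i ℕ.+ 1))))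
        where
        χ : Character (AbelianGroup.group Cl)
        χ = Inverse.to Ĝ-enum Fin.zero

corollary2 : ∀ {c ℓ₁ ℓ₂} (K : HeytingField c ℓ₁ ℓ₂) (isNumberField : IsNumberField K) →
    let open HeytingField K
        open Arithmetic K isNumberField
    in IsPrincipalIdealDomain →
    (α : Carrier) (α∈𝓞 : α ∈ 𝓞) (α#0 : α # 0#) (F : PrimeFactorization α) →
    let open PrimeFactorization F using (e)
    in Finite (AbelianGroup.setoid Cl) ×
       Finite (dual (AbelianGroup.group Cl)) ×
       ((Cl-finite : Finite (AbelianGroup.setoid Cl)) (Ĝ-finite : Finite (dual (AbelianGroup.group Cl))) →
         characterCount α∈𝓞 α#0 F Cl-finite Ĝ-finite ≈ℂ ℕ⇒ℂ (∏ *-1-commutativeMonoid (λ i → e i ℕ.+ 1)))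
corollary2 K isNumberField pid α α∈𝓞 α#0 F =
  singleton-finite (AbelianGroup.setoid Cl) Invertible.ε trivial ,
  singleton-finite (dual G) (trivialCharacter G) χ-trivial ,
  λ Cl-finite Ĝ-finite → characterCount-trivial K isNumberField pid α∈𝓞 α#0 F Cl-finite Ĝ-finite
    (singleton-size (AbelianGroup.setoid Cl) Invertible.ε trivial Cl-finite)
    (singleton-size (dual G) (trivialCharacter G) χ-trivial Ĝ-finite)
  where
  open Arithmetic K isNumberField
  G = AbelianGroup.group Cl
  trivial = class-trivial K isNumberField pid
  χ-trivial = Cl-character-trivial K isNumberField pid
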